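{- Let $n\ge 3$ and let $C_n$ be the cycle graph with $n$ edges $e_1,\dots,e_n$, ordered by $e_1<\cdots<e_n$. Let $\Bbbk$ be a field and write $x_i$ for the variable corresponding to $e_i$. Then $$I_{\mathrm{BC}(C_n)}=(x_1x_2\cdots x_{n-1}),\qquad \Bbbk[\mathrm{BC}(C_n)]=\frac{\Bbbk[x_1,\ldots,x_n]}{(x_1\cdots x_{n-1})},$$ and $$h_{C_n}(z)=1+z+\cdots+z^{n-2},\qquad \mathrm{Hilb}(\Bbbk[\mathrm{BC}(C_n)];z)=\frac{1+z+\cdots+z^{n-2}}{(1-z)^{n-1}}.$$
   Context: For a finite connected loopless graph $G$ with a fixed total order on $E(G)$, a broken circuit is a set $C\setminus\{\max C\}$, where $C$ is the edge set of a cycle of $G$ and $\max C$ is its largest edge. The broken-circuit complex $\mathrm{BC}(G)$ is the simplicial complex on $E(G)$ whose faces are the edge sets containing no broken circuit. Its Stanley--Reisner ring is $\Bbbk[\mathrm{BC}(G)]=\Bbbk[x_e:e\in E(G)]/I_{\mathrm{BC}(G)}$, with $I_{\mathrm{BC}(G)}$ generated by the monomials $\prod_{e\in C\setminus\{\max C\}}x_e$ over all cycles $C$ of $G$; it is graded by $\deg x_e=1$, and $\mathrm{Hilb}$ denotes its Hilbert series. With $r=|V(G)|-1$ and $b_i$ the number of faces of $\mathrm{BC}(G)$ having exactly $i$ elements, the $h$-polynomial of $\mathrm{BC}(G)$ is $h_G(z)=\sum_{i=0}^{r}b_i z^i(1-z)^{r-i}$. -}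

module Defs where

open import Algebra.Apartness.Bundles using (HeytingCommutativeRing; HeytingField)
open import Algebra.Bundles using (CommutativeRing)
open import Algebra.Bundles.Raw using (RawRing)
open import Algebra.Module.Bundles using (Module)
open import Algebra.Module.Structures.Biased using (IsModuleFromLeft)
open import Data.Bool.Base using (if_then_else_)
import Data.Bool.Properties as Boolₚ
open import Data.Fin.Base as Fin using (Fin; zero; suc; toℕ; fromℕ<)
import Data.Fin.Properties as Finₚ
open import Data.Fin.Permutation using (Permutation′; _⟨$⟩ʳ_; _⟨$⟩ˡ_; inverseʳ)
open import Data.Fin.Subset using (Subset; inside; outside; ⁅_⁆; ⋃; _∈_; _⊆_; _-_; ∣_∣)
open import Data.Fin.Subset.Properties using (_∈?_; _⊆?_; anySubset?)
open import Data.Integer.Base as ℤ using (ℤ; +_)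
import Data.Integer.Properties as ℤₚ
open import Data.List.Base as List using (List; []; _∷_; _++_)
open import Data.Nat.Base as ℕ using (ℕ; zero; suc; _≤_; _<_; _∸_; z≤n; s≤s; NonZero)
import Data.Nat.DivMod as DivMod
import Data.Nat.Properties as ℕₚ
open import Data.Product.Base using (Σ; Σ-syntax; ∃; ∃-syntax; _×_; _,_; proj₁; proj₂)
import Data.Product.Properties as Prodₚ
open import Data.Sum.Base using (_⊎_; inj₁; inj₂)
import Data.Sum.Base as Sum
open import Data.Vec.Base as Vec using (Vec; []; _∷_)
import Data.Vec.Properties as Vecₚ
open import Data.Vec.Relation.Unary.AllPairs using (allPairs?)
open import Data.Vec.Relation.Unary.Unique.Propositional using (Unique)
open import Function.Base using (_∘_)
open import Level using (Level; 0ℓ; _⊔_) renaming (suc to lsuc)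
open import Relation.Binary.Construct.Closure.ReflexiveTransitive using (Star; ε; _◅_; _◅◅_)
import Relation.Binary.Construct.Closure.ReflexiveTransitive as Star
open import Relation.Binary.PropositionalEquality using (_≡_; _≢_; refl; sym; trans; cong; cong₂; subst; _≗_; module ≡-Reasoning)
import Relation.Binary.Reasoning.Setoid as SetoidReasoning
open import Relation.Nullary.Decidable using (Dec; yes; no; does; map′; ¬?; _×-dec_; _⊎-dec_)
open import Relation.Nullary.Negation using (¬_; contradiction)
open import Relation.Unary using (Pred; Decidable)

import Algebra.Definitions.RawMonoid as RawMonoidDefs
import Algebra.Definitions.RawSemiring as RawSemiringDefs
import Algebra.Properties.Ring as RingProperties

-- Parallel edges are allowed.  The total order on the edge set is the
-- usual order of Fin #E; the order of each pair of endpoints carries no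
-- meaning.

record Graph : Set where
  field
    #V #E : ℕ
    ends  : Fin #E → Fin #V × Fin #V

  Joins : Fin #E → Fin #V → Fin #V → Set
  Joins e u v = ends e ≡ (u , v) ⊎ ends e ≡ (v , u)

  Adjacent : Fin #V → Fin #V → Set
  Adjacent u v = ∃[ e ] Joins e u v

  field
    nonempty  : NonZero #V
    loopless  : ∀ e → proj₁ (ends e) ≢ proj₂ (ends e)
    connected : ∀ u v → Star Adjacent u v

  rank : ℕ
  rank = #V ∸ 1

-- The cyclic successor i ↦ i + 1 (mod n).

next : ∀ {n} → Fin n → Fin n
next {suc n} i = suc (toℕ i) DivMod.mod suc n

module _ (G : Graph) where
  open Graph G

  -- A cycle v₀ e₀ v₁ e₁ … v_k e_k v₀ with distinct vertices and distinct
  -- edges.  Distinctness of the edges matters for cycles of length two.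

  record IsCycle {k} (vs : Vec (Fin #V) (suc k)) (es : Vec (Fin #E) (suc k)) : Set where
    field
      vertices-distinct : Unique vs
      edges-distinct    : Unique es
      joins             : ∀ i → Joins (Vec.lookup es i) (Vec.lookup vs i) (Vec.lookup vs (next i))

  support : ∀ {k} → Vec (Fin #E) k → Subset #E
  support es = ⋃ (List.map ⁅_⁆ (Vec.toList es))

  IsCycleEdgeSet : Pred (Subset #E) 0ℓ
  IsCycleEdgeSet C = ∃[ k ] Σ[ vs ∈ Vec (Fin #V) (suc k) ] Σ[ es ∈ Vec (Fin #E) (suc k) ]
                       IsCycle vs es × C ≡ support es

  IsMax : Fin #E → Subset #E → Set
  IsMax e C = e ∈ C × (∀ f → f ∈ C → f Fin.≤ e)

  BrokenCircuit : Pred (Subset #E) 0ℓ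
  BrokenCircuit B = ∃[ C ] IsCycleEdgeSet C × ∃[ e ] IsMax e C × B ≡ C - e

anyVec? : ∀ {m k p} {P : Pred (Vec (Fin m) k) p} → Decidable P → Dec (∃ P)
anyVec? {k = zero}  P? = map′ ([] ,_) (λ { ([] , p) → p }) (P? [])
anyVec? {k = suc k} P? =
  map′ (λ { (x , xs , p) → x ∷ xs , p }) (λ { (x ∷ xs , p) → x , xs , p })
       (Finₚ.any? λ x → anyVec? λ xs → P? (x ∷ xs))

unique⇒≤ : ∀ {m k} (xs : Vec (Fin m) k) → Unique xs → k ≤ m
unique⇒≤ xs u = Finₚ.injective⇒≤ (λ {i} {j} → lookup-injective u i j)
  where
  open import Data.Vec.Relation.Unary.Unique.Propositional.Properties using (lookup-injective)

module _ (G : Graph) where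
  open Graph G

  joins? : ∀ e u v → Dec (Joins e u v)
  joins? e u v = ends e ≟ (u , v) ⊎-dec ends e ≟ (v , u)
    where _≟_ = Prodₚ.≡-dec Finₚ._≟_ Finₚ._≟_

  isCycle? : ∀ {k} (vs : Vec (Fin #V) (suc k)) es → Dec (IsCycle G vs es)
  isCycle? vs es =
    map′ (λ { (p , q , r) → record { vertices-distinct = p ; edges-distinct = q ; joins = r } })
         (λ c → IsCycle.vertices-distinct c , IsCycle.edges-distinct c , IsCycle.joins c)
         (unique? vs ×-dec unique? es ×-dec Finₚ.all? λ i → joins? _ _ _)
    where
    unique? : ∀ {m k} → Decidable (Unique {A = Fin m} {n = k})
    unique? = allPairs? (λ x y → ¬? (x Finₚ.≟ y))

  isCycleEdgeSet? : Decidable (IsCycleEdgeSet G)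
  isCycleEdgeSet? C =
    map′ (λ { (k , w) → toℕ k , w })
         (λ { (k , vs , es , c , eq) →
              let k<#V = unique⇒≤ vs (IsCycle.vertices-distinct c) in
              fromℕ< k<#V ,
              subst (λ j → Σ[ vs ∈ Vec (Fin #V) (suc j) ] Σ[ es ∈ Vec (Fin #E) (suc j) ]
                             IsCycle G vs es × C ≡ support G es)
                    (sym (Finₚ.toℕ-fromℕ< k<#V)) (vs , es , c , eq) })
         (Finₚ.any? {n = #V} λ k → anyVec? λ vs → anyVec? λ es →
            isCycle? {toℕ k} vs es ×-dec Vecₚ.≡-dec Boolₚ._≟_ C (support G es))

  isMax? : ∀ e C → Dec (IsMax G e C)
  isMax? e C = e ∈? C ×-dec Finₚ.all? λ f → f ∈? C →-dec f Finₚ.≤? e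
    where open import Relation.Nullary.Decidable using (_→-dec_)

  brokenCircuit? : Decidable (BrokenCircuit G)
  brokenCircuit? B = anySubset? λ C → isCycleEdgeSet? C ×-dec
    Finₚ.any? λ e → isMax? e C ×-dec Vecₚ.≡-dec Boolₚ._≟_ B (C - e)

record SimplicialComplex (m : ℕ) : Set₁ where
  field
    Face     : Pred (Subset m) 0ℓ
    face?    : Decidable Face
    ⊆-closed : ∀ {E F} → E ⊆ F → Face F → Face E

BC : (G : Graph) → SimplicialComplex (Graph.#E G)
BC G = record
  { Face     = λ F → ∀ B → BrokenCircuit G B → ¬ (B ⊆ F)
  ; face?    = λ F → map′ (λ ¬∃ B b B⊆F → ¬∃ (B , b , λ {x} → B⊆F {x})) (λ f (B , b , B⊆F) → f B b B⊆F)
                          (¬? (anySubset? λ B → brokenCircuit? G B ×-dec B ⊆? F))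
  ; ⊆-closed = λ E⊆F f B b B⊆E → f B b λ x∈B → E⊆F (B⊆E x∈B)
  }

subsets : ∀ m → List (Subset m)
subsets zero    = [] ∷ []
subsets (suc m) = List.map (outside ∷_) (subsets m) ++ List.map (inside ∷_) (subsets m)

#faces : ∀ {m} → SimplicialComplex m → ℕ → ℕ
#faces {m} Δ i = List.length (List.filter (λ F → face? F ×-dec ∣ F ∣ ℕₚ.≟ i) (subsets m))
  where open SimplicialComplex Δ

toℕ-next : ∀ {m} (i : Fin (suc m)) → toℕ (next i) ≡ suc (toℕ i) DivMod.% suc m
toℕ-next i = Finₚ.toℕ-fromℕ< _

next-≢ : ∀ {n} → 2 ≤ n → (i : Fin n) → i ≢ next i
next-≢ {suc (suc m)} _ i i≡ with ℕₚ.m≤n⇒m<n∨m≡n (Finₚ.toℕ<n i)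
... | inj₁ lt = ℕₚ.1+n≢n (sym (trans (cong toℕ i≡) (trans (toℕ-next i) (DivMod.m<n⇒m%n≡m lt))))
... | inj₂ eq = contradiction (trans (cong suc (sym toℕi≡0)) eq) λ ()
  where
  toℕi≡0 : toℕ i ≡ 0
  toℕi≡0 = trans (cong toℕ i≡) (trans (toℕ-next i)
             (trans (cong (λ j → j DivMod.% suc (suc m)) eq) (DivMod.n%n≡0 (suc (suc m)))))
next-≢ {suc zero} (s≤s ()) _

private
  module Connected {m} (σ : Permutation′ (suc m)) where
    n = suc m

    Adj : Fin n → Fin n → Set
    Adj u v = ∃[ e ] (ends e ≡ (u , v) ⊎ ends e ≡ (v , u))
      where
      ends : Fin n → Fin n × Fin n
      ends e = σ ⟨$⟩ʳ e , next (σ ⟨$⟩ʳ e)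

    step : ∀ i → Adj i (next i)
    step i = σ ⟨$⟩ˡ i , inj₁ (cong (λ j → j , next j) (inverseʳ σ))

    walk : ∀ k (k<n : k < n) → Star Adj zero (fromℕ< k<n)
    walk zero    (s≤s _) = ε
    walk (suc k) k<n     = walk k k<n′ ◅◅ subst (Adj _) next≡ (step _) ◅ ε
      where
      k<n′ = ℕₚ.<-trans (ℕₚ.n<1+n k) k<n
      next≡ : next (fromℕ< k<n′) ≡ fromℕ< k<n
      next≡ = Finₚ.toℕ-injective (begin
        toℕ (next (fromℕ< k<n′))          ≡⟨ toℕ-next (fromℕ< k<n′) ⟩
        suc (toℕ (fromℕ< k<n′)) DivMod.% n ≡⟨ cong (λ j → suc j DivMod.% n) (Finₚ.toℕ-fromℕ< k<n′) ⟩
        suc k DivMod.% n                  ≡⟨ DivMod.m<n⇒m%n≡m k<n ⟩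
        suc k                             ≡⟨ Finₚ.toℕ-fromℕ< k<n ⟨
        toℕ (fromℕ< k<n)                  ∎)
        where open ≡-Reasoning

    from0 : ∀ v → Star Adj zero v
    from0 v = subst (Star Adj zero) (Finₚ.fromℕ<-toℕ v (Finₚ.toℕ<n v)) (walk (toℕ v) (Finₚ.toℕ<n v))

  cycle-connected : ∀ {n} (σ : Permutation′ n) u v →
                    Star (λ u v → ∃[ e ] ((σ ⟨$⟩ʳ e , next (σ ⟨$⟩ʳ e)) ≡ (u , v)
                                         ⊎ (σ ⟨$⟩ʳ e , next (σ ⟨$⟩ʳ e)) ≡ (v , u))) u v
  cycle-connected {suc m} σ u v = Star.reverse (λ (e , j) → e , Sum.swap j) (from0 u) ◅◅ from0 v
    where open Connected σ

-- Vertices are placed around a circle and the edge at position i joins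
-- vertex i to vertex i + 1 (mod n).  The i-th smallest edge sits at
-- position σ i, so σ ranges over all total orders on the edge set.

cycleGraph : (n : ℕ) → 3 ≤ n → Permutation′ n → Graph
cycleGraph n n≥3 σ = record
  { #V        = n
  ; #E        = n
  ; ends      = λ e → σ ⟨$⟩ʳ e , next (σ ⟨$⟩ʳ e)
  ; nonempty  = ℕ.>-nonZero (ℕₚ.≤-trans (s≤s z≤n) n≥3)
  ; loopless  = λ e → next-≢ (ℕₚ.≤-trans (s≤s (s≤s z≤n)) n≥3) (σ ⟨$⟩ʳ e)
  ; connected = cycle-connected σ
  }

-- A series is its sequence of coefficients.  Polynomials in z are
-- regarded as elements of ℤ[[z]].

ℤ⟦z⟧ : Set
ℤ⟦z⟧ = ℕ → ℤ

∑ : ∀ {k} → (Fin k → ℤ) → ℤ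
∑ = RawMonoidDefs.sum ℤ.+-0-rawMonoid

constant : ℤ → ℤ⟦z⟧
constant a zero    = a
constant a (suc k) = ℤ.0ℤ

z : ℤ⟦z⟧
z 1 = ℤ.1ℤ
z _ = ℤ.0ℤ

ℤ⟦z⟧-rawRing : RawRing 0ℓ 0ℓ
ℤ⟦z⟧-rawRing = record
  { Carrier = ℤ⟦z⟧
  ; _≈_     = _≗_
  ; _+_     = λ A B k → A k ℤ.+ B k
  ; _*_     = λ A B k → ∑ {suc k} λ i → A (toℕ i) ℤ.* B (k ∸ toℕ i)
  ; -_      = λ A k → ℤ.- A k
  ; 0#      = constant ℤ.0ℤ
  ; 1#      = constant ℤ.1ℤ
  }

module Series where
  open RawRing ℤ⟦z⟧-rawRing public
  open RawSemiringDefs rawSemiring public using (sum; _^_)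

1-z : ℤ⟦z⟧
1-z = Series.1# Series.+ (Series.- z)

-- Long division: _÷_ is the quotient in ℤ[[z]] whenever the divisor has
-- constant coefficient 1 (see ÷-*), and is not meaningful otherwise.
-- quotients A B k lists the coefficients of the quotient in degrees
-- k - 1, …, 0, in this order.

quotients : ℤ⟦z⟧ → ℤ⟦z⟧ → ∀ k → Vec ℤ k
quotients A B zero    = []
quotients A B (suc k) =
  A k ℤ.- (∑ {k} λ i → B (suc (toℕ i)) ℤ.* Vec.lookup (quotients A B k) i) ∷ quotients A B k

infixl 7 _÷_
_÷_ : ℤ⟦z⟧ → ℤ⟦z⟧ → ℤ⟦z⟧
(A ÷ B) k = Vec.head (quotients A B (suc k))

÷-* : ∀ A B → B 0 ≡ ℤ.1ℤ → B Series.* (A ÷ B) ≗ A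
÷-* A B B₀≡1 k = begin
  B 0 ℤ.* (A ÷ B) k ℤ.+ tail₁  ≡⟨ cong₂ (λ b t → b ℤ.* (A ÷ B) k ℤ.+ t) B₀≡1 (∑-cong tail≡) ⟩
  ℤ.1ℤ ℤ.* (A ÷ B) k ℤ.+ tail₂ ≡⟨ cong (λ t → t ℤ.+ tail₂) (ℤₚ.*-identityˡ ((A ÷ B) k)) ⟩
  A k ℤ.- tail₂ ℤ.+ tail₂      ≡⟨ ℤₚ.+-assoc (A k) (ℤ.- tail₂) tail₂ ⟩
  A k ℤ.+ (ℤ.- tail₂ ℤ.+ tail₂) ≡⟨ cong (λ t → A k ℤ.+ t) (ℤₚ.+-inverseˡ tail₂) ⟩
  A k ℤ.+ ℤ.0ℤ                 ≡⟨ ℤₚ.+-identityʳ (A k) ⟩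
  A k                          ∎
  where
  open ≡-Reasoning
  tail₁ = ∑ {k} λ i → B (suc (toℕ i)) ℤ.* (A ÷ B) (k ∸ suc (toℕ i))
  tail₂ = ∑ {k} λ i → B (suc (toℕ i)) ℤ.* Vec.lookup (quotients A B k) i

  ∑-cong : ∀ {j} {f g : Fin j → ℤ} → f ≗ g → ∑ f ≡ ∑ g
  ∑-cong {zero}  f≗g = refl
  ∑-cong {suc j} f≗g = cong₂ ℤ._+_ (f≗g zero) (∑-cong (f≗g ∘ suc))

  lookup-quotients : ∀ j (i : Fin j) → (A ÷ B) (j ∸ suc (toℕ i)) ≡ Vec.lookup (quotients A B j) i
  lookup-quotients (suc j) zero    = refl
  lookup-quotients (suc j) (suc i) = lookup-quotients j i

  tail≡ : ∀ i → B (suc (toℕ i)) ℤ.* (A ÷ B) (k ∸ suc (toℕ i))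
              ≡ B (suc (toℕ i)) ℤ.* Vec.lookup (quotients A B k) i
  tail≡ i = cong (B (suc (toℕ i)) ℤ.*_) (lookup-quotients k i)

h-polynomial : Graph → ℤ⟦z⟧
h-polynomial G =
  sum {suc r} λ i → constant (+ #faces (BC G) (toℕ i)) * z ^ toℕ i * 1-z ^ (r ∸ toℕ i)
  where
  open Series
  r = Graph.rank G

module _ {c ℓ : Level} (R : CommutativeRing c ℓ) where
  private module R = CommutativeRing R
  open R using (Carrier; _≈_; _+_; _*_; 0#; 1#)
  open RingProperties R.ring

  record Ideal i : Set (c ⊔ ℓ ⊔ lsuc i) where
    field
      member : Pred Carrier i
      resp   : ∀ {x y} → x ≈ y → member x → member y
      0∈     : member 0#
      +∈     : ∀ {x y} → member x → member y → member (x + y)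
      *∈     : ∀ x {y} → member y → member (x * y)

    -∈ : ∀ {x} → member x → member (R.- x)
    -∈ {x} m = resp (-1*x≈-x x) (*∈ (R.- 1#) m)

  data Generated {s} (S : Pred Carrier s) : Pred Carrier (c ⊔ ℓ ⊔ s) where
    generator : ∀ {x} → S x → Generated S x
    ≈-closed  : ∀ {x y} → x ≈ y → Generated S x → Generated S y
    0-closed  : Generated S 0#
    +-closed  : ∀ {x y} → Generated S x → Generated S y → Generated S (x + y)
    *-closed  : ∀ x {y} → Generated S y → Generated S (x * y)

  ⟨_⟩ : ∀ {s} → Pred Carrier s → Ideal (c ⊔ ℓ ⊔ s)
  ⟨ S ⟩ = record
    { member = Generated S
    ; resp   = ≈-closed
    ; 0∈     = 0-closed
    ; +∈     = +-closed
    ; *∈     = *-closed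
    }

  -- The quotient has the same elements as R; x and y are equal in it when
  -- x - y lies in the ideal.

  quotientRing : ∀ {i} → Ideal i → CommutativeRing c i
  quotientRing I = record
    { Carrier = Carrier
    ; _≈_     = λ x y → member (x R.- y)
    ; _+_     = _+_
    ; _*_     = _*_
    ; -_      = R.-_
    ; 0#      = 0#
    ; 1#      = 1#
    ; isCommutativeRing = record
      { isRing = record
        { +-isAbelianGroup = record
          { isGroup = record
            { isMonoid = record
              { isSemigroup = record
                { isMagma = record
                  { isEquivalence = record
                    { refl  = ≈⇒∼ R.refl
                    ; sym   = ∼-sym
                    ; trans = ∼-trans
                    }
                  ; ∙-cong = +-cong
                  }
                ; assoc = λ x y w → ≈⇒∼ (R.+-assoc x y w)
                }
              ; identity = (λ x → ≈⇒∼ (R.+-identityˡ x)) , (λ x → ≈⇒∼ (R.+-identityʳ x))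
              }
            ; inverse = (λ x → ≈⇒∼ (R.-‿inverseˡ x)) , (λ x → ≈⇒∼ (R.-‿inverseʳ x))
            ; ⁻¹-cong = -‿cong
            }
          ; comm = λ x y → ≈⇒∼ (R.+-comm x y)
          }
        ; *-cong     = *-cong
        ; *-assoc    = λ x y w → ≈⇒∼ (R.*-assoc x y w)
        ; *-identity = (λ x → ≈⇒∼ (R.*-identityˡ x)) , (λ x → ≈⇒∼ (R.*-identityʳ x))
        ; distrib    = (λ x y w → ≈⇒∼ (R.distribˡ x y w)) , (λ x y w → ≈⇒∼ (R.distribʳ x y w))
        }
      ; *-comm = λ x y → ≈⇒∼ (R.*-comm x y)
      }
    }
    where
    open Ideal I
    open SetoidReasoning R.setoid
    open import Algebra.Properties.CommutativeSemigroup R.+-commutativeSemigroup using (interchange)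

    _∼_ : Carrier → Carrier → Set _
    x ∼ y = member (x R.- y)

    ≈⇒∼ : ∀ {x y} → x ≈ y → x ∼ y
    ≈⇒∼ x≈y = resp (R.sym (x≈y⇒x∙y⁻¹≈ε x≈y)) 0∈

    ∼-sym : ∀ {x y} → x ∼ y → y ∼ x
    ∼-sym {x} {y} m = resp (⁻¹-anti-homo-// x y) (-∈ m)

    telescope : ∀ x y w → (x R.- y) + (y R.- w) ≈ x R.- w
    telescope x y w = begin
      (x R.- y) + (y R.- w)   ≈⟨ R.+-assoc x (R.- y) (y R.- w) ⟩
      x + (R.- y + (y R.- w)) ≈⟨ R.+-congˡ (R.+-assoc (R.- y) y (R.- w)) ⟨
      x + ((R.- y + y) R.- w) ≈⟨ R.+-congˡ (R.+-congʳ (R.-‿inverseˡ y)) ⟩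
      x + (0# R.- w)          ≈⟨ R.+-congˡ (R.+-identityˡ (R.- w)) ⟩
      x R.- w                 ∎

    ∼-trans : ∀ {x y w} → x ∼ y → y ∼ w → x ∼ w
    ∼-trans {x} {y} {w} m n = resp (telescope x y w) (+∈ m n)

    +-cong : ∀ {x y u v} → x ∼ y → u ∼ v → (x + u) ∼ (y + v)
    +-cong {x} {y} {u} {v} m n = resp (begin
      (x R.- y) + (u R.- v)     ≈⟨ interchange x (R.- y) u (R.- v) ⟩
      (x + u) + (R.- y R.- v)   ≈⟨ R.+-congˡ (-‿+-comm y v) ⟩
      (x + u) R.- (y + v)       ∎) (+∈ m n)

    -‿cong : ∀ {x y} → x ∼ y → (R.- x) ∼ (R.- y)
    -‿cong {x} {y} m = resp (R.sym (-‿+-comm x (R.- y))) (-∈ m)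

    *-cong : ∀ {x y u v} → x ∼ y → u ∼ v → (x * u) ∼ (y * v)
    *-cong {x} {y} {u} {v} m n = resp (begin
      x * (u R.- v) + v * (x R.- y)           ≈⟨ R.+-cong (x[y-z]≈xy-xz x u v) (x[y-z]≈xy-xz v x y) ⟩
      (x * u R.- x * v) + (v * x R.- v * y)   ≈⟨ R.+-congˡ (R.+-cong (R.*-comm v x) (R.-‿cong (R.*-comm v y))) ⟩
      (x * u R.- x * v) + (x * v R.- y * v)   ≈⟨ telescope (x * u) (x * v) (y * v) ⟩
      x * u R.- y * v                         ∎) (+∈ (*∈ x n) (*∈ v m))

module Polynomial {c ℓ : Level} (K : CommutativeRing c ℓ) (n : ℕ) where
  private module K = CommutativeRing K
  open RingProperties K.ring using (-0#≈0#; -‿distribˡ-*; -‿+-comm)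

  Monomial : Set
  Monomial = Vec ℕ n

  degree : Monomial → ℕ
  degree = Vec.sum

  -- A polynomial is a formal sum of terms, not necessarily with distinct
  -- monomials; two polynomials are equal when they have the same
  -- coefficients.

  Poly : Set c
  Poly = List (K.Carrier × Monomial)

  coeff : Poly → Monomial → K.Carrier
  coeff []            m = K.0#
  coeff ((a , e) ∷ p) m = (if does (Vecₚ.≡-dec ℕₚ._≟_ e m) then a else K.0#) K.+ coeff p m

  infix 4 _≋_
  _≋_ : Poly → Poly → Set ℓ
  p ≋ q = ∀ m → coeff p m K.≈ coeff q m

  1ᵐ : Monomial
  1ᵐ = Vec.replicate n 0

  infixl 7 _·ᵐ_
  _·ᵐ_ : Monomial → Monomial → Monomial
  _·ᵐ_ = Vec.zipWith ℕ._+_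

  const : K.Carrier → Poly
  const a = (a , 1ᵐ) ∷ []

  var : Fin n → Poly
  var i = (K.1# , Vec.replicate n 0 Vec.[ i ]≔ 1) ∷ []

  infixl 7 _·_
  _·_ : Poly → Poly → Poly
  _·_ = List.cartesianProductWith λ (a , d) (b , e) → a K.* b , d ·ᵐ e

  neg : Poly → Poly
  neg = List.map λ (a , e) → K.- a , e

  Homogeneous : ℕ → Pred Poly ℓ
  Homogeneous d p = ∀ m → degree m ≢ d → coeff p m K.≈ K.0#

  open SetoidReasoning K.setoid
  open import Algebra.Properties.CommutativeSemigroup K.+-commutativeSemigroup using (interchange)
  open import Algebra.Properties.CommutativeSemigroup K.*-commutativeSemigroup using (x∙yz≈y∙xz)

  _≟ᵐ_ : (d e : Monomial) → Dec (d ≡ e)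
  _≟ᵐ_ = Vecₚ.≡-dec ℕₚ._≟_

  -- The linear extension of a function on monomials.

  eval : (Monomial → K.Carrier) → Poly → K.Carrier
  eval φ []            = K.0#
  eval φ ((a , e) ∷ p) = a K.* φ e K.+ eval φ p

  δ : Monomial → Monomial → K.Carrier
  δ m e = if does (e ≟ᵐ m) then K.1# else K.0#

  coeff≈eval : ∀ p m → coeff p m K.≈ eval (δ m) p
  coeff≈eval []            m = K.refl
  coeff≈eval ((a , e) ∷ p) m with e ≟ᵐ m
  ... | yes _ = K.+-cong (K.sym (K.*-identityʳ a)) (coeff≈eval p m)
  ... | no  _ = K.+-cong (K.sym (K.zeroʳ a)) (coeff≈eval p m)

  eval⇒≋ : ∀ {p q} → (∀ φ → eval φ p K.≈ eval φ q) → p ≋ q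
  eval⇒≋ {p} {q} h m = K.trans (coeff≈eval p m) (K.trans (h (δ m)) (K.sym (coeff≈eval q m)))

  eval-cong : ∀ {φ ψ} → (∀ e → φ e K.≈ ψ e) → ∀ p → eval φ p K.≈ eval ψ p
  eval-cong h []            = K.refl
  eval-cong h ((a , e) ∷ p) = K.+-cong (K.*-congˡ (h e)) (eval-cong h p)

  eval-0 : ∀ p → eval (λ _ → K.0#) p K.≈ K.0#
  eval-0 []            = K.refl
  eval-0 ((a , e) ∷ p) = K.trans (K.+-cong (K.zeroʳ a) (eval-0 p)) (K.+-identityˡ K.0#)

  eval-+ : ∀ φ ψ p → eval (λ e → φ e K.+ ψ e) p K.≈ eval φ p K.+ eval ψ p
  eval-+ φ ψ []            = K.sym (K.+-identityˡ K.0#)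
  eval-+ φ ψ ((a , e) ∷ p) = K.trans (K.+-cong (K.distribˡ a (φ e) (ψ e)) (eval-+ φ ψ p))
                                     (interchange _ _ _ _)

  eval-* : ∀ b φ p → eval (λ e → b K.* φ e) p K.≈ b K.* eval φ p
  eval-* b φ []            = K.sym (K.zeroʳ b)
  eval-* b φ ((a , e) ∷ p) = K.trans (K.+-cong (x∙yz≈y∙xz a b (φ e)) (eval-* b φ p))
                                     (K.sym (K.distribˡ b _ _))

  eval-++ : ∀ φ p q → eval φ (p ++ q) K.≈ eval φ p K.+ eval φ q
  eval-++ φ []            q = K.sym (K.+-identityˡ _)
  eval-++ φ ((a , e) ∷ p) q = K.trans (K.+-congˡ (eval-++ φ p q)) (K.sym (K.+-assoc _ _ _))

  eval-neg : ∀ φ p → eval φ (neg p) K.≈ K.- eval φ p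
  eval-neg φ []            = K.sym -0#≈0#
  eval-neg φ ((a , e) ∷ p) = K.trans (K.+-cong (K.sym (-‿distribˡ-* a (φ e))) (eval-neg φ p))
                                     (-‿+-comm _ _)

  eval-· : ∀ φ p q → eval φ (p · q) K.≈ eval (λ d → eval (λ e → φ (d ·ᵐ e)) q) p
  eval-· φ []            q = K.refl
  eval-· φ ((a , d) ∷ p) q =
    K.trans (eval-++ φ (List.map _ q) (p · q)) (K.+-cong (eval-term q) (eval-· φ p q))
    where
    eval-term : ∀ q → eval φ (List.map (λ (b , e) → a K.* b , d ·ᵐ e) q)
                        K.≈ a K.* eval (λ e → φ (d ·ᵐ e)) q
    eval-term []            = K.sym (K.zeroʳ a)
    eval-term ((b , e) ∷ q) = K.trans (K.+-cong (K.*-assoc a b _) (eval-term q))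
                                      (K.sym (K.distribˡ a _ _))

  eval-swap : ∀ (φ : Monomial → Monomial → K.Carrier) p q →
              eval (λ d → eval (φ d) q) p K.≈ eval (λ e → eval (λ d → φ d e) p) q
  eval-swap φ []            q = K.sym (eval-0 q)
  eval-swap φ ((a , d) ∷ p) q = begin
    a K.* eval (φ d) q K.+ eval (λ d → eval (φ d) q) p
      ≈⟨ K.+-cong (K.sym (eval-* a (φ d) q)) (eval-swap φ p q) ⟩
    eval (λ e → a K.* φ d e) q K.+ eval (λ e → eval (λ d → φ d e) p) q
      ≈⟨ eval-+ _ _ q ⟨
    eval (λ e → a K.* φ d e K.+ eval (λ d → φ d e) p) q
      ∎

  ·ᵐ-assoc : ∀ d e f → (d ·ᵐ e) ·ᵐ f ≡ d ·ᵐ (e ·ᵐ f)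
  ·ᵐ-assoc = Vecₚ.zipWith-assoc ℕₚ.+-assoc

  ·ᵐ-comm : ∀ d e → d ·ᵐ e ≡ e ·ᵐ d
  ·ᵐ-comm = Vecₚ.zipWith-comm ℕₚ.+-comm

  1ᵐ-identity : ∀ d → 1ᵐ ·ᵐ d ≡ d
  1ᵐ-identity = Vecₚ.zipWith-identityˡ ℕₚ.+-identityˡ

  _÷ᵐ_ : Monomial → Monomial → Monomial
  _÷ᵐ_ = Vec.zipWith _∸_

  ·ᵐ-÷ᵐ : ∀ d e → (d ·ᵐ e) ÷ᵐ e ≡ d
  ·ᵐ-÷ᵐ d e = go d e
    where
    go : ∀ {k} (d e : Vec ℕ k) → Vec.zipWith _∸_ (Vec.zipWith ℕ._+_ d e) e ≡ d
    go []      []      = refl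
    go (x ∷ d) (y ∷ e) = cong₂ _∷_ (ℕₚ.m+n∸n≡m x y) (go d e)

  eval-δ-shift-cong : ∀ {p p′} → p ≋ p′ → ∀ m e →
                      eval (λ d → δ m (d ·ᵐ e)) p K.≈ eval (λ d → δ m (d ·ᵐ e)) p′
  eval-δ-shift-cong {p} {p′} p≋p′ m e with ((m ÷ᵐ e) ·ᵐ e) ≟ᵐ m
  ... | yes eq = begin
    eval (λ d → δ m (d ·ᵐ e)) p  ≈⟨ eval-cong shift p ⟩
    eval (δ (m ÷ᵐ e)) p          ≈⟨ coeff≈eval p (m ÷ᵐ e) ⟨
    coeff p (m ÷ᵐ e)             ≈⟨ p≋p′ (m ÷ᵐ e) ⟩
    coeff p′ (m ÷ᵐ e)            ≈⟨ coeff≈eval p′ (m ÷ᵐ e) ⟩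
    eval (δ (m ÷ᵐ e)) p′         ≈⟨ eval-cong shift p′ ⟨
    eval (λ d → δ m (d ·ᵐ e)) p′ ∎
    where
    shift : ∀ d → δ m (d ·ᵐ e) K.≈ δ (m ÷ᵐ e) d
    shift d with (d ·ᵐ e) ≟ᵐ m | d ≟ᵐ (m ÷ᵐ e)
    ... | yes _   | yes _  = K.refl
    ... | no  _   | no  _  = K.refl
    ... | yes de≡ | no  d≢ = contradiction (trans (sym (·ᵐ-÷ᵐ d e)) (cong (_÷ᵐ e) de≡)) d≢
    ... | no  de≢ | yes d≡ = contradiction (trans (cong (_·ᵐ e) d≡) eq) de≢
  ... | no neq = K.trans (vanish p) (K.sym (vanish p′))
    where
    δ≈0 : ∀ d → δ m (d ·ᵐ e) K.≈ K.0#
    δ≈0 d with (d ·ᵐ e) ≟ᵐ m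
    ... | no  _   = K.refl
    ... | yes de≡ = contradiction
      (trans (cong (λ f → (f ÷ᵐ e) ·ᵐ e) (sym de≡)) (trans (cong (_·ᵐ e) (·ᵐ-÷ᵐ d e)) de≡)) neq

    vanish : ∀ p → eval (λ d → δ m (d ·ᵐ e)) p K.≈ K.0#
    vanish p = K.trans (eval-cong δ≈0 p) (eval-0 p)

  ·-comm : ∀ p q → p · q ≋ q · p
  ·-comm p q = eval⇒≋ {p · q} {q · p} λ φ → begin
    eval φ (p · q)                              ≈⟨ eval-· φ p q ⟩
    eval (λ d → eval (λ e → φ (d ·ᵐ e)) q) p    ≈⟨ eval-swap (λ d e → φ (d ·ᵐ e)) p q ⟩
    eval (λ e → eval (λ d → φ (d ·ᵐ e)) p) q    ≈⟨ eval-cong (λ e → eval-cong (λ d →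
                                                     K.reflexive (cong φ (·ᵐ-comm d e))) p) q ⟩
    eval (λ e → eval (λ d → φ (e ·ᵐ d)) p) q    ≈⟨ eval-· φ q p ⟨
    eval φ (q · p)                              ∎

  ·-congʳ : ∀ {p p′} q → p ≋ p′ → p · q ≋ p′ · q
  ·-congʳ {p} {p′} q p≋p′ m = begin
    coeff (p · q) m                               ≈⟨ expand p ⟩
    eval (λ e → eval (λ d → δ m (d ·ᵐ e)) p) q    ≈⟨ eval-cong (eval-δ-shift-cong {p} {p′} p≋p′ m) q ⟩
    eval (λ e → eval (λ d → δ m (d ·ᵐ e)) p′) q   ≈⟨ expand p′ ⟨
    coeff (p′ · q) m                              ∎
    where
    expand : ∀ p → coeff (p · q) m K.≈ eval (λ e → eval (λ d → δ m (d ·ᵐ e)) p) q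
    expand p = K.trans (coeff≈eval (p · q) m)
                 (K.trans (eval-· (δ m) p q) (eval-swap (λ d e → δ m (d ·ᵐ e)) p q))

  ·-cong : ∀ {p p′ q q′} → p ≋ p′ → q ≋ q′ → p · q ≋ p′ · q′
  ·-cong {p} {p′} {q} {q′} p≋p′ q≋q′ m = begin
    coeff (p · q) m    ≈⟨ ·-congʳ {p} {p′} q p≋p′ m ⟩
    coeff (p′ · q) m   ≈⟨ ·-comm p′ q m ⟩
    coeff (q · p′) m   ≈⟨ ·-congʳ {q} {q′} p′ q≋q′ m ⟩
    coeff (q′ · p′) m  ≈⟨ ·-comm q′ p′ m ⟩
    coeff (p′ · q′) m  ∎

  ·-assoc : ∀ p q r → (p · q) · r ≋ p · (q · r)
  ·-assoc p q r = eval⇒≋ {(p · q) · r} {p · (q · r)} λ φ → begin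
    eval φ ((p · q) · r)
      ≈⟨ eval-· φ (p · q) r ⟩
    eval (λ de → eval (λ f → φ (de ·ᵐ f)) r) (p · q)
      ≈⟨ eval-· _ p q ⟩
    eval (λ d → eval (λ e → eval (λ f → φ ((d ·ᵐ e) ·ᵐ f)) r) q) p
      ≈⟨ eval-cong (λ d → eval-cong (λ e → eval-cong (λ f → K.reflexive (cong φ (·ᵐ-assoc d e f))) r) q) p ⟩
    eval (λ d → eval (λ e → eval (λ f → φ (d ·ᵐ (e ·ᵐ f))) r) q) p
      ≈⟨ eval-cong (λ d → eval-· (λ ef → φ (d ·ᵐ ef)) q r) p ⟨
    eval (λ d → eval (λ ef → φ (d ·ᵐ ef)) (q · r)) p
      ≈⟨ eval-· φ p (q · r) ⟨
    eval φ (p · (q · r))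
      ∎

  eval-const· : ∀ φ a p → eval φ (const a · p) K.≈ a K.* eval φ p
  eval-const· φ a p = begin
    eval φ (const a · p)                          ≈⟨ eval-· φ (const a) p ⟩
    a K.* eval (λ e → φ (1ᵐ ·ᵐ e)) p K.+ K.0#     ≈⟨ K.+-identityʳ _ ⟩
    a K.* eval (λ e → φ (1ᵐ ·ᵐ e)) p              ≈⟨ K.*-congˡ (eval-cong (λ e →
                                                       K.reflexive (cong φ (1ᵐ-identity e))) p) ⟩
    a K.* eval φ p                                ∎

  ·-identityˡ : ∀ p → const K.1# · p ≋ p
  ·-identityˡ p = eval⇒≋ {const K.1# · p} {p} λ φ →
    K.trans (eval-const· φ K.1# p) (K.*-identityˡ _)

  ·-distribʳ : ∀ p q r → (q ++ r) · p ≋ (q · p) ++ (r · p)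
  ·-distribʳ p q r = eval⇒≋ {(q ++ r) · p} {(q · p) ++ (r · p)} λ φ → begin
    eval φ ((q ++ r) · p)                 ≈⟨ eval-· φ (q ++ r) p ⟩
    eval _ (q ++ r)                       ≈⟨ eval-++ _ q r ⟩
    eval _ q K.+ eval _ r                 ≈⟨ K.+-cong (eval-· φ q p) (eval-· φ r p) ⟨
    eval φ (q · p) K.+ eval φ (r · p)     ≈⟨ eval-++ φ (q · p) (r · p) ⟨
    eval φ ((q · p) ++ (r · p))           ∎

  coeff-++ : ∀ p q m → coeff (p ++ q) m K.≈ coeff p m K.+ coeff q m
  coeff-++ p q m = begin
    coeff (p ++ q) m                    ≈⟨ coeff≈eval (p ++ q) m ⟩
    eval (δ m) (p ++ q)                 ≈⟨ eval-++ (δ m) p q ⟩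
    eval (δ m) p K.+ eval (δ m) q       ≈⟨ K.+-cong (coeff≈eval p m) (coeff≈eval q m) ⟨
    coeff p m K.+ coeff q m             ∎

  coeff-neg : ∀ p m → coeff (neg p) m K.≈ K.- coeff p m
  coeff-neg p m = begin
    coeff (neg p) m      ≈⟨ coeff≈eval (neg p) m ⟩
    eval (δ m) (neg p)   ≈⟨ eval-neg (δ m) p ⟩
    K.- eval (δ m) p     ≈⟨ K.-‿cong (coeff≈eval p m) ⟨
    K.- coeff p m        ∎

  coeff-const· : ∀ a p m → coeff (const a · p) m K.≈ a K.* coeff p m
  coeff-const· a p m = begin
    coeff (const a · p) m      ≈⟨ coeff≈eval (const a · p) m ⟩
    eval (δ m) (const a · p)   ≈⟨ eval-const· (δ m) a p ⟩
    a K.* eval (δ m) p         ≈⟨ K.*-congˡ (coeff≈eval p m) ⟨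
    a K.* coeff p m            ∎

  ring : CommutativeRing c ℓ
  ring = record
    { Carrier = Poly
    ; _≈_     = _≋_
    ; _+_     = _++_
    ; _*_     = _·_
    ; -_      = neg
    ; 0#      = []
    ; 1#      = const K.1#
    ; isCommutativeRing = record
      { isRing = record
        { +-isAbelianGroup = record
          { isGroup = record
            { isMonoid = record
              { isSemigroup = record
                { isMagma = record
                  { isEquivalence = record
                    { refl  = λ m → K.refl
                    ; sym   = λ h m → K.sym (h m)
                    ; trans = λ g h m → K.trans (g m) (h m)
                    }
                  ; ∙-cong = λ {p} {p′} {q} {q′} → ++-cong {p} {p′} {q} {q′}
                  }
                ; assoc = λ p q r m → K.reflexive (cong (λ s → coeff s m) (++-assoc p q r))
                }
              ; identity = (λ p m → K.refl) , λ p m → K.reflexive (cong (λ s → coeff s m) (++-identityʳ p))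
              }
            ; inverse = neg-inverseˡ , λ p m → K.trans (++-comm p (neg p) m) (neg-inverseˡ p m)
            ; ⁻¹-cong = λ {p} {q} p≋q m →
                K.trans (coeff-neg p m) (K.trans (K.-‿cong (p≋q m)) (K.sym (coeff-neg q m)))
            }
          ; comm = ++-comm
          }
        ; *-cong     = λ {p} {p′} {q} {q′} → ·-cong {p} {p′} {q} {q′}
        ; *-assoc    = ·-assoc
        ; *-identity = ·-identityˡ , λ p m → K.trans (·-comm p (const K.1#) m) (·-identityˡ p m)
        ; distrib    = ·-distribˡ , ·-distribʳ
        }
      ; *-comm = ·-comm
      }
    }
    where
    open import Data.List.Properties using (++-assoc; ++-identityʳ)

    ++-cong : ∀ {p p′ q q′} → p ≋ p′ → q ≋ q′ → p ++ q ≋ p′ ++ q′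
    ++-cong {p} {p′} {q} {q′} p≋p′ q≋q′ m = begin
      coeff (p ++ q) m            ≈⟨ coeff-++ p q m ⟩
      coeff p m K.+ coeff q m     ≈⟨ K.+-cong (p≋p′ m) (q≋q′ m) ⟩
      coeff p′ m K.+ coeff q′ m   ≈⟨ coeff-++ p′ q′ m ⟨
      coeff (p′ ++ q′) m          ∎

    ++-comm : ∀ p q → p ++ q ≋ q ++ p
    ++-comm p q m = begin
      coeff (p ++ q) m          ≈⟨ coeff-++ p q m ⟩
      coeff p m K.+ coeff q m   ≈⟨ K.+-comm _ _ ⟩
      coeff q m K.+ coeff p m   ≈⟨ coeff-++ q p m ⟨
      coeff (q ++ p) m          ∎

    neg-inverseˡ : ∀ p → neg p ++ p ≋ []
    neg-inverseˡ p m = begin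
      coeff (neg p ++ p) m            ≈⟨ coeff-++ (neg p) p m ⟩
      coeff (neg p) m K.+ coeff p m   ≈⟨ K.+-congʳ (coeff-neg p m) ⟩
      K.- coeff p m K.+ coeff p m     ≈⟨ K.-‿inverseˡ _ ⟩
      K.0#                            ∎

    ·-distribˡ : ∀ p q r → p · (q ++ r) ≋ (p · q) ++ (p · r)
    ·-distribˡ p q r m = begin
      coeff (p · (q ++ r)) m         ≈⟨ ·-comm p (q ++ r) m ⟩
      coeff ((q ++ r) · p) m         ≈⟨ ·-distribʳ p q r m ⟩
      coeff ((q · p) ++ (r · p)) m   ≈⟨ ++-cong {q · p} {p · q} (·-comm q p) (·-comm r p) m ⟩
      coeff ((p · q) ++ (p · r)) m   ∎

  open RawSemiringDefs (RawRing.rawSemiring (CommutativeRing.rawRing ring)) public using (product)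

  -- The degree-d graded piece of the quotient of the polynomial ring by a
  -- homogeneous ideal I: homogeneous polynomials of degree d modulo I.

  gradedPiece : ∀ {i} → Ideal ring i → ℕ → Module K (c ⊔ ℓ) i
  gradedPiece I d = record
    { Carrierᴹ = Σ Poly (Homogeneous d)
    ; _≈ᴹ_     = λ (p , _) (q , _) → p Q.≈ q
    ; _+ᴹ_     = λ (p , hp) (q , hq) → p ++ q , λ m m≢d →
                   K.trans (coeff-++ p q m) (K.trans (K.+-cong (hp m m≢d) (hq m m≢d)) (K.+-identityˡ K.0#))
    ; _*ₗ_     = λ a x → a *ₗ x
    ; _*ᵣ_     = λ x a → a *ₗ x
    ; 0ᴹ       = [] , λ m _ → K.refl
    ; -ᴹ_      = λ (p , hp) → neg p , λ m m≢d →
                   K.trans (coeff-neg p m) (K.trans (K.-‿cong (hp m m≢d)) -0#≈0#)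
    ; isModule = IsModuleFromLeft.isModule {commutativeRing = K} record
      { isLeftModule = record
        { isLeftSemimodule = record
          { +ᴹ-isCommutativeMonoid = record
            { isMonoid = record
              { isSemigroup = record
                { isMagma = record
                  { isEquivalence = record
                    { refl  = λ {(p , _)} → Q.refl {p}
                    ; sym   = λ {(p , _)} {(q , _)} → Q.sym {p} {q}
                    ; trans = λ {(p , _)} {(q , _)} {(r , _)} → Q.trans {p} {q} {r}
                    }
                  ; ∙-cong = λ {(p , _)} {(q , _)} {(r , _)} {(s , _)} → Q.+-cong {p} {q} {r} {s}
                  }
                ; assoc = λ (p , _) (q , _) (r , _) → Q.+-assoc p q r
                }
              ; identity = (λ (p , _) → Q.+-identityˡ p) , (λ (p , _) → Q.+-identityʳ p)
              }
            ; comm = λ (p , _) (q , _) → Q.+-comm p q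
            }
          ; isPreleftSemimodule = record
            { *ₗ-cong      = λ {a} {b} {(p , _)} {(q , _)} a≈b p∼q →
                Q.*-cong {const a} {const b} {p} {q} (≋⇒∼ {const a} {const b} (const-cong a≈b)) p∼q
            ; *ₗ-zeroˡ     = λ (p , _) → ≋⇒∼ {const K.0# · p} {[]} λ m →
                K.trans (coeff-const· K.0# p m) (K.zeroˡ _)
            ; *ₗ-distribʳ  = λ (p , _) a b → ≋⇒∼ {const (a K.+ b) · p} {const a · p ++ const b · p} λ m → begin
                coeff (const (a K.+ b) · p) m                       ≈⟨ coeff-const· (a K.+ b) p m ⟩
                (a K.+ b) K.* coeff p m                             ≈⟨ K.distribʳ _ a b ⟩
                a K.* coeff p m K.+ b K.* coeff p m                 ≈⟨ K.+-cong (coeff-const· a p m) (coeff-const· b p m) ⟨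
                coeff (const a · p) m K.+ coeff (const b · p) m     ≈⟨ coeff-++ (const a · p) (const b · p) m ⟨
                coeff (const a · p ++ const b · p) m                ∎
            ; *ₗ-identityˡ = λ (p , _) → Q.*-identityˡ p
            ; *ₗ-assoc     = λ a b (p , _) → ≋⇒∼ {const (a K.* b) · p} {const a · (const b · p)} λ m → begin
                coeff (const (a K.* b) · p) m         ≈⟨ coeff-const· (a K.* b) p m ⟩
                (a K.* b) K.* coeff p m               ≈⟨ K.*-assoc a b _ ⟩
                a K.* (b K.* coeff p m)               ≈⟨ K.*-congˡ (coeff-const· b p m) ⟨
                a K.* coeff (const b · p) m           ≈⟨ coeff-const· a (const b · p) m ⟨
                coeff (const a · (const b · p)) m     ∎
            ; *ₗ-zeroʳ     = λ a → Q.zeroʳ (const a)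
            ; *ₗ-distribˡ  = λ a (p , _) (q , _) → Q.distribˡ (const a) p q
            }
          }
        ; -ᴹ‿cong    = λ {(p , _)} {(q , _)} → Q.-‿cong {p} {q}
        ; -ᴹ‿inverse = (λ (p , _) → Q.-‿inverseˡ p) , (λ (p , _) → Q.-‿inverseʳ p)
        }
      }
    }
    where
    module P = CommutativeRing ring
    module Q = CommutativeRing (quotientRing ring I)

    ≋⇒∼ : ∀ {p q} → p ≋ q → p Q.≈ q
    ≋⇒∼ {p} {q} p≋q = Ideal.resp I {[]} {p ++ neg q}
      (P.sym {p ++ neg q} {[]} (RingProperties.x≈y⇒x∙y⁻¹≈ε P.ring {p} {q} p≋q)) (Ideal.0∈ I)

    const-cong : ∀ {a b} → a K.≈ b → const a ≋ const b
    const-cong {a} {b} a≈b m with 1ᵐ ≟ᵐ m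
    ... | yes _ = K.+-congʳ a≈b
    ... | no  _ = K.refl

    _*ₗ_ : K.Carrier → Σ Poly (Homogeneous d) → Σ Poly (Homogeneous d)
    a *ₗ (p , hp) = const a · p , λ m m≢d →
      K.trans (coeff-const· a p m) (K.trans (K.*-congˡ (hp m m≢d)) (K.zeroʳ a))

module _ {c ℓ : Level} {K : CommutativeRing c ℓ} where
  private module K = CommutativeRing K

  module _ {m ℓm} (M : Module K m ℓm) where
    open Module M
    open RawMonoidDefs +ᴹ-rawMonoid using (sum)

    record IsBasis {N} (b : Fin N → Carrierᴹ) : Set (c ⊔ ℓ ⊔ m ⊔ ℓm) where
      field
        spanning    : ∀ x → Σ[ a ∈ (Fin N → K.Carrier) ] x ≈ᴹ sum (λ j → a j *ₗ b j)
        independent : ∀ (a : Fin N → K.Carrier) → sum (λ j → a j *ₗ b j) ≈ᴹ 0ᴹ → ∀ j → a j K.≈ K.0#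

    HasDimension : ℕ → Set (c ⊔ ℓ ⊔ m ⊔ ℓm)
    HasDimension N = Σ[ b ∈ (Fin N → Carrierᴹ) ] IsBasis b

  IsHilbertSeries : ∀ {m ℓm} → (ℕ → Module K m ℓm) → ℤ⟦z⟧ → Set (c ⊔ ℓ ⊔ m ⊔ ℓm)
  IsHilbertSeries M H = ∀ d → ∃[ N ] H d ≡ + N × HasDimension (M d) N

-- In a Heyting field apartness x # y means that x - y is invertible, and
-- elements that are not apart are equal; classically these are the fields.

module _ {c ℓ₁ ℓ₂ : Level} (𝕜 : HeytingField c ℓ₁ ℓ₂) where

  underlyingRing : CommutativeRing c ℓ₁
  underlyingRing = HeytingCommutativeRing.commutativeRing (HeytingField.heytingCommutativeRing 𝕜)

  module StanleyReisner (G : Graph) where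
    open Graph G using (#E)
    open Polynomial underlyingRing #E

    squarefree : Subset #E → Poly
    squarefree B = product λ e → if Vec.lookup B e then var e else const K.1#
      where module K = HeytingField 𝕜

    I-BC : Ideal ring (c ⊔ ℓ₁)
    I-BC = ⟨ ring ⟩ λ p → ∃[ B ] BrokenCircuit G B × p ≡ squarefree B

    𝕜[BC] : CommutativeRing c (c ⊔ ℓ₁)
    𝕜[BC] = quotientRing ring I-BC

    𝕜[BC]-graded : ℕ → Module underlyingRing (c ⊔ ℓ₁) (c ⊔ ℓ₁)
    𝕜[BC]-graded = gradedPiece I-BC

module Submission where

-- Of the two edges at vertex v of Cₙ, one sits at position v and the other at
-- position v − 1, and a cycle uses both whenever it visits v.  So the positions
-- used by a cycle are closed under v ↦ v + 1, the only cycle is Cₙ itself, and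
-- its only broken circuit is {e₁, …, eₙ₋₁}.
--
-- Write r = n − 1 and h_r for the h-polynomial.  Sorting the faces by whether they
-- contain e₁ gives h_{r+1} = 1 + z h_r.  Sorting the monomials not divisible by x₁⋯xᵣ by whether
-- x₁ occurs in them gives s_{r+1} = (1 − z)^{-(r+1)} + z s_r / (1 − z) for their
-- generating function, so (1 − z)^r s_r satisfies the same recursion as h_r.
-- These monomials form a basis of the quotient because a polynomial lies in the
-- ideal exactly when its coefficients at all of them vanish.

open import Defs
open import Algebra.Apartness.Bundles using (HeytingField)
open import Algebra.Bundles using (CommutativeRing)
open import Algebra.Module.Bundles using (Module)
open import Algebra.Morphism.Structures using (module RingMorphisms)
open import Data.Bool.Base using (true; false; if_then_else_)
open import Data.Fin.Base using (Fin; zero; suc; toℕ; fromℕ; inject₁; inject≤)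
open import Data.Fin.Permutation using (Permutation′; _⟨$⟩ʳ_; _⟨$⟩ˡ_; inverseʳ; inverseˡ)
open import Data.Empty using (⊥)
import Data.Fin.Properties as Finₚ
import Data.Fin.Subset as Subset
open import Data.Fin.Subset using (Subset; inside; outside)
open import Data.Integer.Base as ℤ using (ℤ; +_; 0ℤ; 1ℤ)
import Data.Integer.Properties as ℤₚ
open import Data.Integer.Tactic.RingSolver using (solve-∀)
open import Data.List.Base as List using (List; []; _∷_; _++_)
import Data.List.Properties as Listₚ
open import Data.Nat.Base as ℕ using (ℕ; zero; suc; _≤_; _<_; _∸_; z≤n; s≤s; s≤s⁻¹)
import Data.Nat.Properties as ℕₚ
open import Data.Nat.Properties using (m∸n≤m)
open import Data.Product.Base using (Σ-syntax; ∃-syntax; _×_; _,_; proj₁; proj₂; map₁)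
open import Data.Vec.Base as Vec using (Vec; []; _∷_)
import Data.Vec.Properties as Vecₚ
open import Data.Vec.Relation.Binary.Pointwise.Inductive using (Pointwise; []; _∷_; decidable)
open import Function.Base using (id; _∘_; case_of_)
open import Function.Definitions using (Injective)
import Level
open import Relation.Binary.PropositionalEquality as ≡ using (_≡_; _≢_; _≗_; refl; cong; cong₂; subst; module ≡-Reasoning)
open import Relation.Nullary.Decidable using (Dec; yes; no; does; ¬?; _×-dec_)
open import Relation.Nullary.Negation using (¬_; contradiction)
open import Relation.Unary using (Pred; Decidable; _≐_; ｛_｝; U)

-- Formal power series over ℤ, division by powers of 1 - z, and passage from face numbers to
-- h-polynomials.

module PowerSeries where

  import Algebra.Properties.CommutativeMonoid.Sum as Sums
  open ≡ using (sym; trans)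

  module ∑ = Sums ℤₚ.+-0-commutativeMonoid

  -- shift and Δ are multiplication by z and by 1 − z.  Moving these two operators
  -- through products replaces associativity of the product of series.

  shift : ℤ⟦z⟧ → ℤ⟦z⟧
  shift A zero    = 0ℤ
  shift A (suc k) = A k

  Δ : ℤ⟦z⟧ → ℤ⟦z⟧
  Δ A k = A k ℤ.- shift A k

  shift-cong : ∀ {A B} → A ≗ B → shift A ≗ shift B
  shift-cong A≗B zero    = refl
  shift-cong A≗B (suc k) = A≗B k

  shift-Δ : ∀ A → shift (Δ A) ≗ Δ (shift A)
  shift-Δ A zero    = refl
  shift-Δ A (suc k) = refl

  Δ-cong : ∀ {A B} → A ≗ B → Δ A ≗ Δ B
  Δ-cong A≗B k = cong₂ ℤ._-_ (A≗B k) (shift-cong A≗B k)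

  -- Coefficients are recovered in increasing degree from `A k = Δ A k + A (k − 1)`, so 1 - z can be
  -- cancelled.
  Δ-injective : ∀ {A B} → Δ A ≗ Δ B → A ≗ B
  Δ-injective {A} {B} ΔA≗ΔB = go
    where
    split : ∀ C k → C k ≡ Δ C k ℤ.+ shift C k
    split C k = add-back (C k) (shift C k)
      where
      add-back : ∀ a b → a ≡ a ℤ.- b ℤ.+ b
      add-back = solve-∀

    go : A ≗ B
    go k = trans (split A k) (trans (cong₂ ℤ._+_ (ΔA≗ΔB k) (shifted k)) (sym (split B k)))
      where
      shifted : ∀ k → shift A k ≡ shift B k
      shifted zero    = refl
      shifted (suc k) = go k

  ∑-distrib-- : ∀ {n} (f g : Fin n → ℤ) → ∑ (λ i → f i ℤ.- g i) ≡ ∑ f ℤ.- ∑ g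
  ∑-distrib-- {zero}  f g = refl
  ∑-distrib-- {suc n} f g =
    trans (cong (ℤ._+_ (f zero ℤ.- g zero)) (∑-distrib-- (f ∘ suc) (g ∘ suc)))
          (regroup (f zero) (g zero) _ _)
    where
    regroup : ∀ a b c d → a ℤ.- b ℤ.+ (c ℤ.- d) ≡ a ℤ.+ c ℤ.- (b ℤ.+ d)
    regroup = solve-∀

  open Series using (_*_; _^_)

  *-cong : ∀ {A A′ B B′} → A ≗ A′ → B ≗ B′ → A * B ≗ A′ * B′
  *-cong A≗A′ B≗B′ k = ∑.sum-cong-≗ {suc k} λ i → cong₂ ℤ._*_ (A≗A′ (toℕ i)) (B≗B′ (k ∸ toℕ i))

  *-congˡ : ∀ A {B B′} → B ≗ B′ → A * B ≗ A * B′
  *-congˡ A = *-cong {A} λ _ → refl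

  *-congʳ : ∀ {A A′} B → A ≗ A′ → A * B ≗ A′ * B
  *-congʳ B A≗A′ = *-cong A≗A′ λ _ → refl

  *-distribˡ-+ : ∀ A B C k → (A * (B Series.+ C)) k ≡ (A * B) k ℤ.+ (A * C) k
  *-distribˡ-+ A B C k =
    trans (∑.sum-cong-≗ {suc k} λ i → ℤₚ.*-distribˡ-+ (A (toℕ i)) (B (k ∸ toℕ i)) (C (k ∸ toℕ i)))
          (∑.∑-distrib-+ {suc k} (λ i → A (toℕ i) ℤ.* B (k ∸ toℕ i)) (λ i → A (toℕ i) ℤ.* C (k ∸ toℕ i)))

  shift-* : ∀ A B → shift A * B ≗ shift (A * B)
  shift-* A B zero    = refl
  shift-* A B (suc k) = ℤₚ.+-identityˡ _

  -- Unlike in `shift-*`, the term that vanishes is the last of the sum, so the coefficients of `A`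
  -- are peeled off from the front until it is reached.
  *-shift : ∀ A B → A * shift B ≗ shift (A * B)
  *-shift A B zero    = trans (ℤₚ.+-identityʳ _) (ℤₚ.*-zeroʳ (A 0))
  *-shift A B (suc k) = trans (cong (ℤ._+_ (A 0 ℤ.* B k)) (*-shift (A ∘ suc) B k)) (collect k)
    where
    collect : ∀ k → A 0 ℤ.* B k ℤ.+ shift ((A ∘ suc) * B) k ≡ (A * B) k
    collect zero    = refl
    collect (suc k) = refl

  *-Δ : ∀ A B → A * Δ B ≗ Δ (A * B)
  *-Δ A B k = begin
    (A * Δ B) k
      ≡⟨ ∑.sum-cong-≗ {suc k} (λ i → distrib (A (toℕ i)) (B (k ∸ toℕ i)) (shift B (k ∸ toℕ i))) ⟩
    ∑ {suc k} (λ i → A (toℕ i) ℤ.* B (k ∸ toℕ i) ℤ.- A (toℕ i) ℤ.* shift B (k ∸ toℕ i))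
      ≡⟨ ∑-distrib-- {suc k} (λ i → A (toℕ i) ℤ.* B (k ∸ toℕ i)) (λ i → A (toℕ i) ℤ.* shift B (k ∸ toℕ i)) ⟩
    (A * B) k ℤ.- (A * shift B) k
      ≡⟨ cong (ℤ._-_ ((A * B) k)) (*-shift A B k) ⟩
    Δ (A * B) k ∎
    where
    open ≡-Reasoning
    distrib : ∀ a b c → a ℤ.* (b ℤ.- c) ≡ a ℤ.* b ℤ.- a ℤ.* c
    distrib = solve-∀

  Δ-* : ∀ A B → Δ A * B ≗ Δ (A * B)
  Δ-* A B k = begin
    (Δ A * B) k
      ≡⟨ ∑.sum-cong-≗ {suc k} (λ i → distrib (A (toℕ i)) (shift A (toℕ i)) (B (k ∸ toℕ i))) ⟩
    ∑ {suc k} (λ i → A (toℕ i) ℤ.* B (k ∸ toℕ i) ℤ.- shift A (toℕ i) ℤ.* B (k ∸ toℕ i))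
      ≡⟨ ∑-distrib-- {suc k} (λ i → A (toℕ i) ℤ.* B (k ∸ toℕ i)) (λ i → shift A (toℕ i) ℤ.* B (k ∸ toℕ i)) ⟩
    (A * B) k ℤ.- (shift A * B) k
      ≡⟨ cong (ℤ._-_ ((A * B) k)) (shift-* A B k) ⟩
    Δ (A * B) k ∎
    where
    open ≡-Reasoning
    distrib : ∀ a b c → (a ℤ.- b) ℤ.* c ≡ a ℤ.* c ℤ.- b ℤ.* c
    distrib = solve-∀

  constant-* : ∀ a A k → (constant a * A) k ≡ a ℤ.* A k
  constant-* a A zero    = ℤₚ.+-identityʳ _
  constant-* a A (suc k) = trans (cong (ℤ._+_ (a ℤ.* A (suc k))) (∑.sum-replicate-zero (suc k))) (ℤₚ.+-identityʳ _)

  constant-*-1 : ∀ a → constant a * Series.1# ≗ constant a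
  constant-*-1 a zero    = trans (constant-* a Series.1# 0) (ℤₚ.*-identityʳ a)
  constant-*-1 a (suc k) = trans (constant-* a Series.1# (suc k)) (ℤₚ.*-zeroʳ a)

  1-* : ∀ A → Series.1# * A ≗ A
  1-* A k = trans (constant-* 1ℤ A k) (ℤₚ.*-identityˡ (A k))

  z-* : ∀ A → z * A ≗ shift A
  z-* A k = trans (*-congʳ A z≗shift-1 k) (trans (shift-* Series.1# A k) (shift-cong (1-* A) k))
    where
    z≗shift-1 : z ≗ shift Series.1#
    z≗shift-1 0             = refl
    z≗shift-1 1             = refl
    z≗shift-1 (suc (suc _)) = refl

  1-z-* : ∀ A → 1-z * A ≗ Δ A
  1-z-* A k = trans (*-congʳ A 1-z≗Δ1 k) (trans (Δ-* Series.1# A k) (Δ-cong (1-* A) k))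
    where
    1-z≗Δ1 : 1-z ≗ Δ Series.1#
    1-z≗Δ1 0             = refl
    1-z≗Δ1 1             = refl
    1-z≗Δ1 (suc (suc _)) = refl

  -- One factor 1 - z leaves the power and acts on `A` instead. This is the induction step both for
  -- cancelling a power and for computing the generating functions of monomials.
  1-z^suc-* : ∀ j A → 1-z ^ suc j * A ≗ 1-z ^ j * Δ A
  1-z^suc-* j A k =
    trans (*-congʳ A (1-z-* (1-z ^ j)) k) (trans (Δ-* (1-z ^ j) A k) (sym (*-Δ (1-z ^ j) A k)))

  1-z^-0 : ∀ j → (1-z ^ j) 0 ≡ 1ℤ
  1-z^-0 zero    = refl
  1-z^-0 (suc j) = trans (1-z-* (1-z ^ j) 0) (trans (ℤₚ.+-identityʳ _) (1-z^-0 j))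

  1-z^-cancel : ∀ j {A B} → 1-z ^ j * A ≗ 1-z ^ j * B → A ≗ B
  1-z^-cancel zero    {A} {B} eq k = trans (sym (1-* A k)) (trans (eq k) (1-* B k))
  1-z^-cancel (suc j) {A} {B} eq   = Δ-injective (1-z^-cancel j λ k →
    trans (sym (1-z^suc-* j A k)) (trans (eq k) (1-z^suc-* j B k)))

  -- Long division gives one solution of (1 - z)^j X = A, since the divisor has constant coefficient
  -- 1, and cancellation shows that there is no other.
  ÷-unique : ∀ j {A Q} → 1-z ^ j * Q ≗ A → A ÷ 1-z ^ j ≗ Q
  ÷-unique j {A} eq = 1-z^-cancel j λ k → trans (÷-* A (1-z ^ j) (1-z^-0 j) k) (sym (eq k))

  sum-coefficient : ∀ {n} (F : Fin n → ℤ⟦z⟧) k → Series.sum F k ≡ ∑ λ i → F i k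
  sum-coefficient {zero}  F zero    = refl
  sum-coefficient {zero}  F (suc k) = refl
  sum-coefficient {suc n} F k       = cong (ℤ._+_ (F zero k)) (sum-coefficient (F ∘ suc) k)

  sum-cong : ∀ {n} {F G : Fin n → ℤ⟦z⟧} → (∀ i → F i ≗ G i) → Series.sum F ≗ Series.sum G
  sum-cong {F = F} {G} F≗G k =
    trans (sum-coefficient F k) (trans (∑.sum-cong-≗ λ i → F≗G i k) (sym (sum-coefficient G k)))

  sum-shift : ∀ {n} (F : Fin n → ℤ⟦z⟧) → Series.sum (shift ∘ F) ≗ shift (Series.sum F)
  sum-shift {n} F zero    = trans (sum-coefficient (shift ∘ F) 0) (∑.sum-replicate-zero n)
  sum-shift     F (suc k) = trans (sum-coefficient (shift ∘ F) (suc k)) (sym (sum-coefficient F k))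

  geometric : ℕ → ℤ⟦z⟧
  geometric r = Series.sum λ (i : Fin r) → z ^ toℕ i

  geometric-suc : ∀ r k → geometric (suc r) k ≡ Series.1# k ℤ.+ shift (geometric r) k
  geometric-suc r k = cong (ℤ._+_ (Series.1# k))
    (trans (sum-cong (λ (i : Fin r) → z-* (z ^ toℕ i)) k) (sum-shift (λ (i : Fin r) → z ^ toℕ i) k))

  -- The h-polynomial of a complex of dimension r − 1 with f i faces of i elements.

  fToH : ℕ → (ℕ → ℤ) → ℤ⟦z⟧
  fToH r f = Series.sum {suc r} λ i → constant (f (toℕ i)) * z ^ toℕ i * 1-z ^ (r ∸ toℕ i)

  fToH-zero : ∀ f k → fToH 0 f k ≡ f 0 ℤ.* Series.1# k
  fToH-zero f k = begin
    (constant (f 0) * Series.1# * Series.1#) k ℤ.+ Series.0# k ≡⟨ cong₂ ℤ._+_ (term k) (0#-coefficient k) ⟩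
    f 0 ℤ.* Series.1# k ℤ.+ 0ℤ                               ≡⟨ ℤₚ.+-identityʳ _ ⟩
    f 0 ℤ.* Series.1# k                                      ∎
    where
    open ≡-Reasoning
    0#-coefficient : ∀ k → Series.0# k ≡ 0ℤ
    0#-coefficient zero    = refl
    0#-coefficient (suc k) = refl
    term : ∀ k → (constant (f 0) * Series.1# * Series.1#) k ≡ f 0 ℤ.* Series.1# k
    term k = trans (*-congʳ Series.1# (constant-*-1 (f 0)) k) (constant-* (f 0) Series.1# k)

  -- The term for the empty face is split off. Every later term carries a factor z, and (r + 1) - (i
  -- + 1) = r - i leaves the terms for the shifted face numbers.
  fToH-suc : ∀ r f k → fToH (suc r) f k ≡ f 0 ℤ.* (1-z ^ suc r) k ℤ.+ shift (fToH r (f ∘ suc)) k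
  fToH-suc r f k = cong₂ ℤ._+_ (first k)
    (trans (sum-cong {F = λ i → term′ i} {shift ∘ term} later k) (sum-shift term k))
    where
    term term′ : Fin (suc r) → ℤ⟦z⟧
    term  i = constant (f (suc (toℕ i))) * z ^ toℕ i * 1-z ^ (r ∸ toℕ i)
    term′ i = constant (f (suc (toℕ i))) * z ^ suc (toℕ i) * 1-z ^ (r ∸ toℕ i)
    first : ∀ k → (constant (f 0) * Series.1# * 1-z ^ suc r) k ≡ f 0 ℤ.* (1-z ^ suc r) k
    first k = trans (*-congʳ (1-z ^ suc r) (constant-*-1 (f 0)) k) (constant-* (f 0) (1-z ^ suc r) k)
    later : ∀ i → term′ i ≗ shift (term i)
    later i k = trans (*-congʳ (1-z ^ (r ∸ toℕ i)) (λ j →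
        trans (*-congˡ (constant (f (suc (toℕ i)))) (z-* (z ^ toℕ i)) j)
              (*-shift (constant (f (suc (toℕ i)))) (z ^ toℕ i) j)) k)
      (shift-* (constant (f (suc (toℕ i))) * z ^ toℕ i) (1-z ^ (r ∸ toℕ i)) k)

  fToH-cong : ∀ r {f g} → f ≗ g → fToH r f ≗ fToH r g
  fToH-cong r {f} {g} f≗g = sum-cong {suc r} λ i k →
    cong (λ a → (constant a * z ^ toℕ i * 1-z ^ (r ∸ toℕ i)) k) (f≗g (toℕ i))

  fToH-+ : ∀ r f g k → fToH r (λ i → f i ℤ.+ g i) k ≡ fToH r f k ℤ.+ fToH r g k
  fToH-+ zero f g k = begin
    fToH 0 (λ i → f i ℤ.+ g i) k                   ≡⟨ fToH-zero (λ i → f i ℤ.+ g i) k ⟩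
    (f 0 ℤ.+ g 0) ℤ.* Series.1# k                  ≡⟨ ℤₚ.*-distribʳ-+ (Series.1# k) (f 0) (g 0) ⟩
    f 0 ℤ.* Series.1# k ℤ.+ g 0 ℤ.* Series.1# k    ≡⟨ cong₂ ℤ._+_ (fToH-zero f k) (fToH-zero g k) ⟨
    fToH 0 f k ℤ.+ fToH 0 g k                      ∎
    where open ≡-Reasoning
  fToH-+ (suc r) f g k = begin
    fToH (suc r) (λ i → f i ℤ.+ g i) k
      ≡⟨ fToH-suc r (λ i → f i ℤ.+ g i) k ⟩
    (f 0 ℤ.+ g 0) ℤ.* P ℤ.+ shift (fToH r λ i → f (suc i) ℤ.+ g (suc i)) k
      ≡⟨ cong (ℤ._+_ ((f 0 ℤ.+ g 0) ℤ.* P)) (shift-+ k) ⟩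
    (f 0 ℤ.+ g 0) ℤ.* P ℤ.+ (shift (fToH r (f ∘ suc)) k ℤ.+ shift (fToH r (g ∘ suc)) k)
      ≡⟨ regroup (f 0) (g 0) P _ _ ⟩
    f 0 ℤ.* P ℤ.+ shift (fToH r (f ∘ suc)) k ℤ.+ (g 0 ℤ.* P ℤ.+ shift (fToH r (g ∘ suc)) k)
      ≡⟨ cong₂ ℤ._+_ (fToH-suc r f k) (fToH-suc r g k) ⟨
    fToH (suc r) f k ℤ.+ fToH (suc r) g k
      ∎
    where
    open ≡-Reasoning
    P = (1-z ^ suc r) k
    shift-+ : ∀ k → shift (fToH r λ i → f (suc i) ℤ.+ g (suc i)) k
                  ≡ shift (fToH r (f ∘ suc)) k ℤ.+ shift (fToH r (g ∘ suc)) k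
    shift-+ zero    = refl
    shift-+ (suc k) = fToH-+ r (f ∘ suc) (g ∘ suc) k
    regroup : ∀ a b p x y → (a ℤ.+ b) ℤ.* p ℤ.+ (x ℤ.+ y) ≡ a ℤ.* p ℤ.+ x ℤ.+ (b ℤ.* p ℤ.+ y)
    regroup = solve-∀

  -- Adding a new vertex to every face shifts the face numbers and multiplies the h-polynomial by z:
  -- there is no empty face left to contribute.
  fToH-shift : ∀ r f → fToH (suc r) (shift f) ≗ shift (fToH r f)
  fToH-shift r f k = trans (fToH-suc r (shift f) k) (ℤₚ.+-identityˡ _)

  -- Each exponent r - i grows by one, which gives the factor 1 - z. The one additional summand is f
  -- (r + 1) z^(r + 1), which the hypothesis removes.
  fToH-Δ : ∀ r f → f (suc r) ≡ 0ℤ → fToH (suc r) f ≗ Δ (fToH r f)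
  fToH-Δ zero f f₁≡0 k = begin
    fToH 1 f k
      ≡⟨ fToH-suc 0 f k ⟩
    f 0 ℤ.* (1-z * Series.1#) k ℤ.+ shift (fToH 0 (f ∘ suc)) k
      ≡⟨ cong₂ (λ a b → f 0 ℤ.* a ℤ.+ b) (1-z-* Series.1# k) (vanish k) ⟩
    f 0 ℤ.* (Series.1# k ℤ.- shift Series.1# k) ℤ.+ 0ℤ
      ≡⟨ regroup (f 0) (Series.1# k) (shift Series.1# k) ⟩
    f 0 ℤ.* Series.1# k ℤ.- f 0 ℤ.* shift Series.1# k
      ≡⟨ cong₂ ℤ._-_ (fToH-zero f k) (shifted k) ⟨
    Δ (fToH 0 f) k
      ∎
    where
    open ≡-Reasoning
    vanish : ∀ k → shift (fToH 0 (f ∘ suc)) k ≡ 0ℤ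
    vanish zero    = refl
    vanish (suc k) = trans (fToH-zero (f ∘ suc) k) (cong (ℤ._* Series.1# k) f₁≡0)
    shifted : ∀ k → shift (fToH 0 f) k ≡ f 0 ℤ.* shift Series.1# k
    shifted zero    = sym (ℤₚ.*-zeroʳ (f 0))
    shifted (suc k) = fToH-zero f k
    regroup : ∀ a p q → a ℤ.* (p ℤ.- q) ℤ.+ 0ℤ ≡ a ℤ.* p ℤ.- a ℤ.* q
    regroup = solve-∀
  fToH-Δ (suc r) f fᵣ≡0 k = begin
    fToH (suc (suc r)) f k
      ≡⟨ fToH-suc (suc r) f k ⟩
    f 0 ℤ.* (1-z * P) k ℤ.+ shift (fToH (suc r) (f ∘ suc)) k
      ≡⟨ cong₂ (λ a b → f 0 ℤ.* a ℤ.+ b) (1-z-* P k)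
           (trans (shift-cong (fToH-Δ r (f ∘ suc) fᵣ≡0) k) (shift-Δ (fToH r (f ∘ suc)) k)) ⟩
    f 0 ℤ.* (P k ℤ.- shift P k) ℤ.+ (shift H k ℤ.- shift (shift H) k)
      ≡⟨ regroup (f 0) (P k) _ _ _ ⟩
    f 0 ℤ.* P k ℤ.+ shift H k ℤ.- (f 0 ℤ.* shift P k ℤ.+ shift (shift H) k)
      ≡⟨ cong₂ ℤ._-_ (fToH-suc r f k) (shifted k) ⟨
    Δ (fToH (suc r) f) k
      ∎
    where
    open ≡-Reasoning
    P = 1-z ^ suc r
    H = fToH r (f ∘ suc)
    shifted : ∀ k → shift (fToH (suc r) f) k ≡ f 0 ℤ.* shift P k ℤ.+ shift (shift H) k
    shifted zero    = trans (sym (ℤₚ.*-zeroʳ (f 0))) (sym (ℤₚ.+-identityʳ _))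
    shifted (suc k) = fToH-suc r f k
    regroup : ∀ a p q x y → a ℤ.* (p ℤ.- q) ℤ.+ (x ℤ.- y) ≡ a ℤ.* p ℤ.+ x ℤ.- (a ℤ.* q ℤ.+ y)
    regroup = solve-∀

-- Face numbers of the full simplex and of the complex of sets not containing {e₁, ..., eᵣ}.

module FaceCounting where

  open import Data.Fin.Subset.Properties using (_⊆?_; drop-∷-⊆; s⊆s; ∣p∣≤n)
  import Data.List.Relation.Unary.All as All
  open PowerSeries
  open ≡ using (sym; trans)
  open Subset using (_⊆_; ∣_∣)
  open import Data.Vec.Base using (here; there)

  length-filter-map : ∀ {a b p} {A : Set a} {B : Set b} {P : Pred B p} (P? : Decidable P) (f : A → B) xs →
                      List.length (List.filter P? (List.map f xs)) ≡ List.length (List.filter (P? ∘ f) xs)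
  length-filter-map P? f []       = refl
  length-filter-map P? f (x ∷ xs) with does (P? (f x))
  ... | true  = cong suc (length-filter-map P? f xs)
  ... | false = length-filter-map P? f xs

  count : ∀ {m p} {P : Pred (Subset m) p} → Decidable P → ℕ
  count {m} P? = List.length (List.filter P? (subsets m))

  count-≐ : ∀ {m p q} {P : Pred (Subset m) p} {Q : Pred (Subset m) q} (P? : Decidable P) (Q? : Decidable Q) →
            P ≐ Q → count P? ≡ count Q?
  count-≐ {m} P? Q? P≐Q = cong List.length (Listₚ.filter-≐ P? Q? P≐Q (subsets m))

  count-∅ : ∀ {m p} {P : Pred (Subset m) p} (P? : Decidable P) → (∀ F → ¬ P F) → count P? ≡ 0
  count-∅ {m} P? ¬P = cong List.length (Listₚ.filter-none P? (All.universal ¬P (subsets m)))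

  count-suc : ∀ {m p} {P : Pred (Subset (suc m)) p} (P? : Decidable P) →
              count P? ≡ count (P? ∘ (outside ∷_)) ℕ.+ count (P? ∘ (inside ∷_))
  count-suc {m} P? = begin
    count P?
      ≡⟨ cong List.length (Listₚ.filter-++ P? (List.map (outside ∷_) (subsets m)) _) ⟩
    List.length (List.filter P? (List.map (outside ∷_) (subsets m)) ++ List.filter P? (List.map (inside ∷_) (subsets m)))
      ≡⟨ Listₚ.length-++ (List.filter P? (List.map (outside ∷_) (subsets m))) ⟩
    List.length (List.filter P? (List.map (outside ∷_) (subsets m))) ℕ.+ List.length (List.filter P? (List.map (inside ∷_) (subsets m)))
      ≡⟨ cong₂ ℕ._+_ (length-filter-map P? (outside ∷_) (subsets m)) (length-filter-map P? (inside ∷_) (subsets m)) ⟩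
    count (P? ∘ (outside ∷_)) ℕ.+ count (P? ∘ (inside ∷_))
      ∎
    where open ≡-Reasoning

  #subsets : ℕ → ℕ → ℕ
  #subsets m i = count {m} λ F → ∣ F ∣ ℕₚ.≟ i

  #subsets-suc : ∀ m i → + #subsets (suc m) i ≡ + #subsets m i ℤ.+ shift (λ j → + #subsets m j) i
  #subsets-suc m i = trans (cong +_ (count-suc {m} (λ F → ∣ F ∣ ℕₚ.≟ i)))
                           (cong (ℤ._+_ (+ #subsets m i)) (with-first i))
    where
    with-first : ∀ i → + count {m} (λ F → suc ∣ F ∣ ℕₚ.≟ i) ≡ shift (λ j → + #subsets m j) i
    with-first zero    = cong +_ (count-∅ {m} (λ F → suc ∣ F ∣ ℕₚ.≟ 0) λ _ ())
    with-first (suc i) = cong +_ (count-≐ {m} (λ F → suc ∣ F ∣ ℕₚ.≟ suc i) (λ F → ∣ F ∣ ℕₚ.≟ i) (ℕₚ.suc-injective , cong suc))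

  #subsets-> : ∀ m i → m < i → #subsets m i ≡ 0
  #subsets-> m i m<i = count-∅ {m} (λ F → ∣ F ∣ ℕₚ.≟ i) λ F ∣F∣≡i →
    ℕₚ.<⇒≱ m<i (subst (ℕ._≤ m) ∣F∣≡i (∣p∣≤n F))

  -- This is the binomial identity (z + (1 - z))^m = 1: subsets without the first element contribute
  -- 1 - z times the previous value, those with it z times.
  fToH-#subsets : ∀ m → fToH m (λ i → + #subsets m i) ≗ Series.1#
  fToH-#subsets zero    k = trans (fToH-zero (λ i → + #subsets 0 i) k) (ℤₚ.*-identityˡ _)
  fToH-#subsets (suc m) k = begin
    fToH (suc m) (λ i → + #subsets (suc m) i) k
      ≡⟨ fToH-cong (suc m) (#subsets-suc m) k ⟩
    fToH (suc m) (λ i → c i ℤ.+ shift c i) k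
      ≡⟨ fToH-+ (suc m) c (shift c) k ⟩
    fToH (suc m) c k ℤ.+ fToH (suc m) (shift c) k
      ≡⟨ cong₂ ℤ._+_ (fToH-Δ m c (cong +_ (#subsets-> m (suc m) (ℕₚ.n<1+n m))) k) (fToH-shift m c k) ⟩
    Δ (fToH m c) k ℤ.+ shift (fToH m c) k
      ≡⟨ cancel _ _ ⟩
    fToH m c k
      ≡⟨ fToH-#subsets m k ⟩
    Series.1# k
      ∎
    where
    open ≡-Reasoning
    c : ℕ → ℤ
    c i = + #subsets m i
    cancel : ∀ a b → a ℤ.- b ℤ.+ b ≡ a
    cancel = solve-∀

  -- The broken circuit {e₁, ..., eᵣ} of the cycle with r + 1 edges, given recursively so that it
  -- can be split along the first edge as in `count-suc`.
  allButLast : ∀ r → Subset (suc r)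
  allButLast zero    = outside ∷ []
  allButLast (suc r) = inside ∷ allButLast r

  avoiding? : ∀ r i → Decidable (λ F → ¬ (allButLast r ⊆ F) × ∣ F ∣ ≡ i)
  avoiding? r i F = ¬? (allButLast r ⊆? F) ×-dec ∣ F ∣ ℕₚ.≟ i

  #avoiding : ℕ → ℕ → ℕ
  #avoiding r i = count (avoiding? r i)

  #avoiding-zero : ∀ i → #avoiding 0 i ≡ 0
  #avoiding-zero i = count-∅ (avoiding? 0 i) λ F (⊈ , _) → ⊈ λ { (there ()) }

  -- A set that misses e₁ cannot contain {e₁, ..., eᵣ₊₁}, so its other r + 1 edges are arbitrary. A
  -- set with e₁ avoids it exactly when the rest avoids the corresponding set for r.
  #avoiding-suc : ∀ r i → + #avoiding (suc r) i ≡ + #subsets (suc r) i ℤ.+ shift (λ j → + #avoiding r j) i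
  #avoiding-suc r i = trans (cong +_ (count-suc (avoiding? (suc r) i)))
    (cong₂ ℤ._+_ (cong +_ without-first) (with-first i))
    where
    without-first : count (avoiding? (suc r) i ∘ (outside ∷_)) ≡ #subsets (suc r) i
    without-first = count-≐ (avoiding? (suc r) i ∘ (outside ∷_)) (λ F → ∣ F ∣ ℕₚ.≟ i)
      (proj₂ , λ ∣F∣≡i → (λ ⊆ → case ⊆ here of λ ()) , ∣F∣≡i)
    with-first : ∀ i → + count (avoiding? (suc r) i ∘ (inside ∷_)) ≡ shift (λ j → + #avoiding r j) i
    with-first zero    = cong +_ (count-∅ (avoiding? (suc r) 0 ∘ (inside ∷_)) λ { _ (_ , ()) })
    with-first (suc i) = cong +_ (count-≐ (avoiding? (suc r) (suc i) ∘ (inside ∷_)) (avoiding? r i)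
      ( (λ (⊈ , ≡i) → (λ ⊆ → ⊈ (s⊆s λ {x} → ⊆ {x})) , ℕₚ.suc-injective ≡i)
      , (λ (⊈ , ≡i) → (λ ⊆ → ⊈ (drop-∷-⊆ λ {x} → ⊆ {x})) , cong suc ≡i)))

  fToH-#avoiding : ∀ r → fToH r (λ i → + #avoiding r i) ≗ geometric r
  fToH-#avoiding zero    k = trans (fToH-zero (λ i → + #avoiding 0 i) k)
    (trans (cong (λ a → + a ℤ.* Series.1# k) (#avoiding-zero 0)) (sym (sum-coefficient {0} (λ ()) k)))
  fToH-#avoiding (suc r) k = begin
    fToH (suc r) (λ i → + #avoiding (suc r) i) k
      ≡⟨ fToH-cong (suc r) (#avoiding-suc r) k ⟩
    fToH (suc r) (λ i → + #subsets (suc r) i ℤ.+ shift f i) k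
      ≡⟨ fToH-+ (suc r) (λ i → + #subsets (suc r) i) (shift f) k ⟩
    fToH (suc r) (λ i → + #subsets (suc r) i) k ℤ.+ fToH (suc r) (shift f) k
      ≡⟨ cong₂ ℤ._+_ (fToH-#subsets (suc r) k) (fToH-shift r f k) ⟩
    Series.1# k ℤ.+ shift (fToH r f) k
      ≡⟨ cong (ℤ._+_ (Series.1# k)) (shift-cong (fToH-#avoiding r) k) ⟩
    Series.1# k ℤ.+ shift (geometric r) k
      ≡⟨ geometric-suc r k ⟨
    geometric (suc r) k
      ∎
    where
    open ≡-Reasoning
    f : ℕ → ℤ
    f i = + #avoiding r i

  #faces-avoiding : ∀ {r} (X : SimplicialComplex (suc r)) →
                    SimplicialComplex.Face X ≐ (λ F → ¬ (allButLast r ⊆ F)) → ∀ i → #faces X i ≡ #avoiding r i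
  #faces-avoiding {r} X (⇒ , ⇐) i = count-≐ (λ F → face? F ×-dec ∣ F ∣ ℕₚ.≟ i) (avoiding? r i) (map₁ ⇒ , map₁ ⇐)
    where open SimplicialComplex X using (face?)

-- The cycles and broken circuits of the cycle graph.

module CycleGraph where

  open import Data.Fin.Induction using (<-weakInduction; <-weakInduction-startingFrom)
  open import Data.Fin.Relation.Unary.Top using (view; ‵fromℕ; ‵inject₁)
  open import Data.Fin.Subset.Properties using (∈⊤; ⊆⊤; ⊆-antisym; x∈⁅x⁆; p⊆p∪q; q⊆p∪q)
  import Data.Nat.DivMod as DivMod
  open import Data.Product.Properties using (,-injectiveˡ; ,-injectiveʳ)
  open import Data.Sum.Base using (inj₁; inj₂; _⊎_; [_,_]′)
  open import Data.Vec.Relation.Unary.Unique.Propositional.Properties using (tabulate⁺; lookup-injective)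
  open FaceCounting
  open ≡ using (sym; trans)
  open Subset using (⊤; ⁅_⁆; _∈_; _-_)

  next-inject₁ : ∀ {m} (i : Fin m) → next (inject₁ i) ≡ suc i
  next-inject₁ {m} i = Finₚ.toℕ-injective (begin
    toℕ (next (inject₁ i))               ≡⟨ toℕ-next (inject₁ i) ⟩
    suc (toℕ (inject₁ i)) DivMod.% suc m ≡⟨ cong (λ j → suc j DivMod.% suc m) (Finₚ.toℕ-inject₁ i) ⟩
    suc (toℕ i) DivMod.% suc m           ≡⟨ DivMod.m<n⇒m%n≡m (s≤s (Finₚ.toℕ<n i)) ⟩
    suc (toℕ i)                          ∎)
    where open ≡-Reasoning

  next-fromℕ : ∀ m → next (fromℕ m) ≡ zero
  next-fromℕ m = Finₚ.toℕ-injective (begin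
    toℕ (next (fromℕ m))               ≡⟨ toℕ-next (fromℕ m) ⟩
    suc (toℕ (fromℕ m)) DivMod.% suc m ≡⟨ cong (λ j → suc j DivMod.% suc m) (Finₚ.toℕ-fromℕ m) ⟩
    suc m DivMod.% suc m               ≡⟨ DivMod.n%n≡0 (suc m) ⟩
    0                                  ∎)
    where open ≡-Reasoning

  prev : ∀ {m} → Fin (suc m) → Fin (suc m)
  prev {m} zero    = fromℕ m
  prev     (suc i) = inject₁ i

  next-prev : ∀ {m} (i : Fin (suc m)) → next (prev i) ≡ i
  next-prev {m} zero    = next-fromℕ m
  next-prev     (suc i) = next-inject₁ i

  prev-next : ∀ {m} (i : Fin (suc m)) → prev (next i) ≡ i
  prev-next {m} i with view i
  ... | ‵fromℕ     = cong prev (next-fromℕ m)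
  ... | ‵inject₁ j = cong prev (next-inject₁ j)

  next-injective : ∀ {m} {i j : Fin (suc m)} → next i ≡ next j → i ≡ j
  next-injective {i = i} {j} eq = trans (sym (prev-next i)) (trans (cong prev eq) (prev-next j))

  -- Successors of the given position reach the last one, which wraps around to zero. Ordinary
  -- induction from zero then reaches every position.
  next-closed⇒universal : ∀ {m p} (P : Pred (Fin (suc m)) p) → (∀ i → P i → P (next i)) → ∀ {i} → P i → ∀ j → P j
  next-closed⇒universal {m} P closed Pᵢ = <-weakInduction P P₀ step
    where
    step : ∀ i → P (inject₁ i) → P (suc i)
    step i = subst P (next-inject₁ i) ∘ closed (inject₁ i)
    P₀ : P zero
    P₀ = subst P (next-fromℕ m) (closed (fromℕ m) (<-weakInduction-startingFrom P Pᵢ step (Finₚ.≤fromℕ _)))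

  lookup∈support : ∀ G {k} (es : Vec (Fin (Graph.#E G)) k) i → Vec.lookup es i ∈ support G es
  lookup∈support G (e ∷ es) zero    = p⊆p∪q (support G es) (x∈⁅x⁆ e)
  lookup∈support G (e ∷ es) (suc i) = q⊆p∪q ⁅ e ⁆ (support G es) (lookup∈support G es i)

  ⊤-last : ∀ r → ⊤ - fromℕ r ≡ allButLast r
  ⊤-last zero    = refl
  ⊤-last (suc r) = cong (inside ∷_) (⊤-last r)

  module _ {m} (n≥3 : 3 ≤ suc m) (σ : Permutation′ (suc m)) where
    private
      n = suc m
      G = cycleGraph n n≥3 σ
    open Graph G using (Joins; loopless)

    edgeAt : Fin n → Fin n
    edgeAt p = σ ⟨$⟩ˡ p

    position : Fin n → Fin n
    position e = σ ⟨$⟩ʳ e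

    position-injective : ∀ {e f} → position e ≡ position f → e ≡ f
    position-injective {e} {f} eq = trans (sym (inverseˡ σ)) (trans (cong edgeAt eq) (inverseˡ σ))

    joins-left : ∀ {e u v} → Joins e u v → position e ≡ u ⊎ next (position e) ≡ u
    joins-left (inj₁ eq) = inj₁ (,-injectiveˡ eq)
    joins-left (inj₂ eq) = inj₂ (,-injectiveʳ eq)

    joins-right : ∀ {e u v} → Joins e u v → position e ≡ v ⊎ next (position e) ≡ v
    joins-right (inj₁ eq) = inj₂ (,-injectiveʳ eq)
    joins-right (inj₂ eq) = inj₁ (,-injectiveˡ eq)

    next-endpoint : ∀ {e u v} → Joins e u v → next (position e) ≡ u ⊎ next (position e) ≡ v
    next-endpoint (inj₁ eq) = inj₂ (,-injectiveʳ eq)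
    next-endpoint (inj₂ eq) = inj₁ (,-injectiveʳ eq)

    -- At v meet only the edges at positions v and prev v.

    one-leaves : ∀ {e f v} → e ≢ f → position e ≡ v ⊎ next (position e) ≡ v →
                 position f ≡ v ⊎ next (position f) ≡ v → position e ≡ v ⊎ position f ≡ v
    one-leaves e≢f (inj₁ eq) _         = inj₁ eq
    one-leaves e≢f (inj₂ _)  (inj₁ eq) = inj₂ eq
    one-leaves e≢f (inj₂ eq) (inj₂ eq′) =
      contradiction (position-injective (next-injective (trans eq (sym eq′)))) e≢f

    consecutive-edges-distinct : ∀ {k} {vs es : Vec (Fin n) (suc k)} → IsCycle G vs es →
                                 ∀ i → Vec.lookup es i ≢ Vec.lookup es (next i)
    -- In length one `next` fixes the only index, so the two edges coincide and the case must be
    -- refuted: the edge would be a loop.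
    consecutive-edges-distinct {zero} {v ∷ []} c zero _ =
      [ (λ eq → loopless _ (trans (,-injectiveˡ eq) (sym (,-injectiveʳ eq))))
      , (λ eq → loopless _ (trans (,-injectiveˡ eq) (sym (,-injectiveʳ eq)))) ]′ (IsCycle.joins c zero)
    consecutive-edges-distinct {suc _} c i eq =
      next-≢ (s≤s (s≤s z≤n)) i (lookup-injective (IsCycle.edges-distinct c) i (next i) eq)

    module _ {k} {vs es : Vec (Fin n) (suc k)} (c : IsCycle G vs es) where
      open IsCycle c

      -- Vertices and positions share the type `Fin n`: position p is that of the edge from vertex p
      -- to `next p`, so `Used` can be asked of a vertex too.
      Used : Pred (Fin n) _
      Used p = ∃[ i ] position (Vec.lookup es i) ≡ p

      -- The cycle edges before and after the vertex are distinct and both meet it, so one of them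
      -- sits at its position. Writing the index as `next (prev i)` makes `joins` apply to both
      -- edges.
      vertex-used : ∀ i → Used (Vec.lookup vs i)
      vertex-used i = subst (Used ∘ Vec.lookup vs) (next-prev i)
        ([ (prev i ,_) , (next (prev i) ,_) ]′
          (one-leaves (consecutive-edges-distinct c (prev i))
                      (joins-right (joins (prev i))) (joins-left (joins (next (prev i))))))

      -- The edge at position p has `next p` as an endpoint, so the cycle visits that vertex and
      -- `vertex-used` applies to it.
      used-closed : ∀ p → Used p → Used (next p)
      used-closed _ (i , refl) with next-endpoint (joins i)
      ... | inj₁ eq = subst Used (sym eq) (vertex-used i)
      ... | inj₂ eq = subst Used (sym eq) (vertex-used (next i))

      cycle-support : support G es ≡ ⊤
      cycle-support = ⊆-antisym ⊆⊤ λ {e} _ →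
        let i , eq = next-closed⇒universal Used used-closed (zero , refl) (position e)
        in  subst (_∈ support G es) (position-injective eq) (lookup∈support G es i)

    fullCycle : IsCycle G (Vec.tabulate id) (Vec.tabulate edgeAt)
    fullCycle = record
      { vertices-distinct = tabulate⁺ id
      ; edges-distinct    = tabulate⁺ λ eq → trans (sym (inverseʳ σ)) (trans (cong position eq) (inverseʳ σ))
      ; joins             = λ i → inj₁ (cong₂ _,_ (start i) (end i))
      }
      where
      start : ∀ i → position (Vec.lookup (Vec.tabulate edgeAt) i) ≡ Vec.lookup (Vec.tabulate id) i
      start i = trans (cong position (Vecₚ.lookup∘tabulate edgeAt i)) (trans (inverseʳ σ) (sym (Vecₚ.lookup∘tabulate id i)))
      end : ∀ i → next (position (Vec.lookup (Vec.tabulate edgeAt) i)) ≡ Vec.lookup (Vec.tabulate id) (next i)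
      end i = trans (cong next (trans (start i) (Vecₚ.lookup∘tabulate id i))) (sym (Vecₚ.lookup∘tabulate id (next i)))

    max-⊤ : ∀ {e} → IsMax G e ⊤ → e ≡ fromℕ m
    max-⊤ {e} (_ , max) = Finₚ.≤-antisym (Finₚ.≤fromℕ e) (max (fromℕ m) ∈⊤)

    -- The cycle uses all edges, so the edge removed is the last element of `Fin n`. Edges are
    -- numbered by rank in the order, which makes the answer the same for every `σ`.
    brokenCircuit⇒ : ∀ {B} → BrokenCircuit G B → B ≡ allButLast m
    brokenCircuit⇒ (C , (k , vs , es , c , refl) , e , max , refl) rewrite cycle-support c =
      trans (cong (⊤ -_) (max-⊤ max)) (⊤-last m)

    brokenCircuit-allButLast : BrokenCircuit G (allButLast m)
    brokenCircuit-allButLast =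
      ⊤ , (m , Vec.tabulate id , Vec.tabulate edgeAt , fullCycle , sym (cycle-support fullCycle)) ,
      fromℕ m , (∈⊤ , λ f _ → Finₚ.≤fromℕ f) , sym (⊤-last m)

-- Enumeration by degree of the monomials not divisible by x₁⋯xᵣ.

module StandardMonomials where

  open import Data.List.Membership.Propositional using (_∈_)
  open import Data.List.Membership.Propositional.Properties using (∈-map⁺; ∈-map⁻; ∈-++⁺ˡ; ∈-++⁺ʳ; ∈-++⁻)
  open import Data.List.Relation.Unary.Any using (here)
  open import Data.List.Relation.Unary.All using ([])
  open import Data.List.Relation.Unary.AllPairs using ([]; _∷_)
  open import Data.List.Relation.Unary.Unique.Propositional using (Unique)
  open import Data.List.Relation.Unary.Unique.Propositional.Properties using (map⁺; ++⁺)
  open import Data.Sum.Base using ([_,_]′)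
  open PowerSeries
  open ≡ using (sym; trans)

  open Series using (_*_; _^_)

  record Enumerates {a p} {A : Set a} (P : Pred A p) (xs : List A) : Set (a Level.⊔ p) where
    field
      unique   : Unique xs
      sound    : ∀ {x} → x ∈ xs → P x
      complete : ∀ {x} → P x → x ∈ xs

  enumerates-resp : ∀ {a p q} {A : Set a} {P : Pred A p} {Q : Pred A q} {xs} → P ≐ Q → Enumerates P xs → Enumerates Q xs
  enumerates-resp (P⊆Q , Q⊆P) e = record { unique = unique ; sound = P⊆Q ∘ sound ; complete = complete ∘ Q⊆P }
    where open Enumerates e

  enumerates-∅ : ∀ {a p} {A : Set a} {P : Pred A p} → (∀ x → ¬ P x) → Enumerates P []
  enumerates-∅ ¬P = record { unique = [] ; sound = λ () ; complete = λ {x} Px → contradiction Px (¬P x) }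

  raise : ∀ {n} → Vec ℕ (suc n) → Vec ℕ (suc n)
  raise (x ∷ m) = suc x ∷ m

  raise-injective : ∀ {n} {m m′ : Vec ℕ (suc n)} → raise m ≡ raise m′ → m ≡ m′
  raise-injective {m = _ ∷ _} {_ ∷ _} eq = cong₂ _∷_ (ℕₚ.suc-injective (Vecₚ.∷-injectiveˡ eq)) (Vecₚ.∷-injectiveʳ eq)

  -- `xs` supplies the monomials without x₁, and `ys` those with x₁ after one factor x₁ has been
  -- taken off.
  byHead : ∀ {n} → List (Vec ℕ n) → List (Vec ℕ (suc n)) → List (Vec ℕ (suc n))
  byHead xs ys = List.map (0 ∷_) xs ++ List.map raise ys

  length-byHead : ∀ {n} (xs : List (Vec ℕ n)) ys → List.length (byHead xs ys) ≡ List.length xs ℕ.+ List.length ys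
  length-byHead xs ys = trans (Listₚ.length-++ (List.map (0 ∷_) xs))
    (cong₂ ℕ._+_ (Listₚ.length-map (0 ∷_) xs) (Listₚ.length-map raise ys))

  enumerates-byHead : ∀ {n p} {P : Pred (Vec ℕ (suc n)) p} {xs ys} →
                      Enumerates (P ∘ (0 ∷_)) xs → Enumerates (P ∘ raise) ys → Enumerates P (byHead xs ys)
  enumerates-byHead {P = P} {xs} {ys} e f = record
    { unique   = ++⁺ (map⁺ Vecₚ.∷-injectiveʳ E.unique) (map⁺ raise-injective F.unique)
                     (λ (∈xs , ∈ys) → disjoint (∈-map⁻ (0 ∷_) ∈xs) (∈-map⁻ raise ∈ys))
    ; sound    = [ from-xs ∘ ∈-map⁻ (0 ∷_) , from-ys ∘ ∈-map⁻ raise ]′ ∘ ∈-++⁻ (List.map (0 ∷_) xs)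
    ; complete = complete _
    }
    where
    module E = Enumerates e
    module F = Enumerates f

    disjoint : ∀ {m} → ∃[ x ] (x ∈ xs × m ≡ 0 ∷ x) → ∃[ y ] (y ∈ ys × m ≡ raise y) → ⊥
    disjoint (_ , _ , refl) (_ ∷ _ , _ , ())

    from-xs : ∀ {m} → ∃[ x ] (x ∈ xs × m ≡ 0 ∷ x) → P m
    from-xs (_ , ∈xs , refl) = E.sound ∈xs

    from-ys : ∀ {m} → ∃[ y ] (y ∈ ys × m ≡ raise y) → P m
    from-ys (_ , ∈ys , refl) = F.sound ∈ys

    complete : ∀ m → P m → m ∈ byHead xs ys
    complete (zero  ∷ m) Pm = ∈-++⁺ˡ (∈-map⁺ (0 ∷_) (E.complete Pm))
    complete (suc x ∷ m) Pm = ∈-++⁺ʳ (List.map (0 ∷_) xs) (∈-map⁺ raise (F.complete {x ∷ m} Pm))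

  OfDegree : ∀ {n p} → Pred (Vec ℕ n) p → ℕ → Pred (Vec ℕ n) p
  OfDegree P d m = P m × Vec.sum m ≡ d

  -- Monomials with a free exponent of a new variable x₁ and the rest taken from `L`. The recursion
  -- on degree removes one factor x₁ at a time. On generating functions this is division by 1 - z,
  -- as `Δ-lengths-anyHead` confirms.
  anyHead : ∀ {n} → (ℕ → List (Vec ℕ n)) → ℕ → List (Vec ℕ (suc n))
  anyHead L zero    = byHead (L zero) []
  anyHead L (suc d) = byHead (L (suc d)) (anyHead L d)

  enumerates-anyHead : ∀ {n p} {P : Pred (Vec ℕ n) p} {L} →
                       (∀ d → Enumerates (OfDegree P d) (L d)) →
                       ∀ d → Enumerates (OfDegree (P ∘ Vec.tail) d) (anyHead L d)
  enumerates-anyHead e zero    = enumerates-byHead (e zero) (enumerates-∅ λ { (_ ∷ _) (_ , ()) })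
  enumerates-anyHead {P = P} e (suc d) = enumerates-byHead (e (suc d))
    (enumerates-resp ((λ {m} → raised m) , λ {m} → lowered m) (enumerates-anyHead e d))
    where
    raised : ∀ m → OfDegree (P ∘ Vec.tail) d m → OfDegree (P ∘ Vec.tail) (suc d) (raise m)
    raised (_ ∷ _) (Pm , refl) = Pm , refl
    lowered : ∀ m → OfDegree (P ∘ Vec.tail) (suc d) (raise m) → OfDegree (P ∘ Vec.tail) d m
    lowered (_ ∷ _) (Pm , refl) = Pm , refl

  lengths : ∀ {n} → (ℕ → List (Vec ℕ n)) → ℤ⟦z⟧
  lengths L d = + List.length (L d)

  Δ-lengths-anyHead : ∀ {n} (L : ℕ → List (Vec ℕ n)) → Δ (lengths (anyHead L)) ≗ lengths L
  Δ-lengths-anyHead L zero = trans (ℤₚ.+-identityʳ _) (cong +_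
    (trans (length-byHead (L 0) []) (ℕₚ.+-identityʳ _)))
  Δ-lengths-anyHead L (suc d) = trans
    (cong (λ l → + l ℤ.- lengths (anyHead L) d) (length-byHead (L (suc d)) (anyHead L d)))
    (cancel (lengths L (suc d)) (lengths (anyHead L) d))
    where
    cancel : ∀ a b → a ℤ.+ b ℤ.- b ≡ a
    cancel = solve-∀

  monomials : ∀ n → ℕ → List (Vec ℕ n)
  monomials zero    zero    = [] ∷ []
  monomials zero    (suc d) = []
  monomials (suc n) d       = anyHead (monomials n) d

  enumerates-monomials : ∀ n d → Enumerates (OfDegree U d) (monomials n d)
  enumerates-monomials zero zero = record
    { unique   = [] ∷ []
    ; sound    = λ { (here refl) → _ , refl }
    ; complete = λ { {[]} _ → here refl }
    }
  enumerates-monomials zero    (suc d) = enumerates-∅ λ { [] (_ , ()) }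
  enumerates-monomials (suc n) d       = enumerates-anyHead (enumerates-monomials n) d

  1-z^-*-monomials : ∀ n → 1-z ^ n * lengths (monomials n) ≗ Series.1#
  1-z^-*-monomials zero k = trans (1-* (lengths (monomials 0)) k) (only-1 k)
    where
    only-1 : lengths (monomials 0) ≗ Series.1#
    only-1 zero    = refl
    only-1 (suc k) = refl
  1-z^-*-monomials (suc n) k = begin
    (1-z ^ suc n * lengths (anyHead (monomials n))) k ≡⟨ 1-z^suc-* n (lengths (anyHead (monomials n))) k ⟩
    (1-z ^ n * Δ (lengths (anyHead (monomials n)))) k ≡⟨ *-congˡ (1-z ^ n) (Δ-lengths-anyHead (monomials n)) k ⟩
    (1-z ^ n * lengths (monomials n)) k               ≡⟨ 1-z^-*-monomials n k ⟩
    Series.1# k                                       ∎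
    where open ≡-Reasoning

  -- The exponent vector of x₁⋯xᵣ in r + 1 variables. Comparison by `Pointwise _≤_` is divisibility
  -- of monomials.
  onesButLast : ∀ r → Vec ℕ (suc r)
  onesButLast zero    = 0 ∷ []
  onesButLast (suc r) = 1 ∷ onesButLast r

  Standard : ∀ r → Pred (Vec ℕ (suc r)) _
  Standard r m = ¬ Pointwise _≤_ (onesButLast r) m

  -- For r = 0 the product is 1 and divides everything. Otherwise a monomial without x₁ is always
  -- standard. One with x₁ loses a factor x₁, after which the exponent of x₁ is free and the other
  -- variables must form a standard monomial for r.
  standardMonomials : ∀ r → ℕ → List (Vec ℕ (suc r))
  standardMonomials zero    d       = []
  standardMonomials (suc r) zero    = byHead (monomials (suc r) zero) []
  standardMonomials (suc r) (suc d) = byHead (monomials (suc r) (suc d)) (anyHead (standardMonomials r) d)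

  enumerates-standard : ∀ r d → Enumerates (OfDegree (Standard r) d) (standardMonomials r d)
  enumerates-standard zero d = enumerates-∅ λ { (_ ∷ []) (std , _) → std (z≤n ∷ []) }
  enumerates-standard (suc r) d = from d
    where
    zero-head : ∀ d → Enumerates (OfDegree (Standard (suc r)) d ∘ (0 ∷_)) (monomials (suc r) d)
    zero-head d = enumerates-resp (map₁ (λ { _ (() ∷ _) }) , map₁ _) (enumerates-monomials (suc r) d)

    raised : ∀ d m → OfDegree (Standard r ∘ Vec.tail) d m → OfDegree (Standard (suc r)) (suc d) (raise m)
    raised d (_ ∷ _) (std , refl) = (λ { (_ ∷ ≤m) → std ≤m }) , refl

    lowered : ∀ d m → OfDegree (Standard (suc r)) (suc d) (raise m) → OfDegree (Standard r ∘ Vec.tail) d m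
    lowered d (_ ∷ _) (std , refl) = (λ ≤m → std (s≤s z≤n ∷ ≤m)) , refl

    from : ∀ d → Enumerates (OfDegree (Standard (suc r)) d) (standardMonomials (suc r) d)
    from zero    = enumerates-byHead (zero-head zero) (enumerates-∅ λ { (_ ∷ _) (_ , ()) })
    from (suc d) = enumerates-byHead (zero-head (suc d))
      (enumerates-resp ((λ {m} → raised d m) , λ {m} → lowered d m) (enumerates-anyHead (enumerates-standard r) d))

  lengths-standard-suc : ∀ r k → lengths (standardMonomials (suc r)) k
    ≡ lengths (monomials (suc r)) k ℤ.+ shift (lengths (anyHead (standardMonomials r))) k
  lengths-standard-suc r zero    = cong +_ (length-byHead (monomials (suc r) 0) [])
  lengths-standard-suc r (suc d) = cong +_ (length-byHead (monomials (suc r) (suc d)) (anyHead (standardMonomials r) d))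

  1-z^-*-standard : ∀ r → 1-z ^ r * lengths (standardMonomials r) ≗ geometric r
  1-z^-*-standard zero k = trans (1-* (lengths (standardMonomials 0)) k) (sym (sum-coefficient {0} (λ ()) k))
  1-z^-*-standard (suc r) k = begin
    (P′ * lengths (standardMonomials (suc r))) k
      ≡⟨ *-congˡ P′ (lengths-standard-suc r) k ⟩
    (P′ * (M Series.+ shift S)) k
      ≡⟨ *-distribˡ-+ P′ M (shift S) k ⟩
    (P′ * M) k ℤ.+ (P′ * shift S) k
      ≡⟨ cong₂ ℤ._+_ (1-z^-*-monomials (suc r) k) (trans (*-shift P′ S k) (shift-cong P′*S k)) ⟩
    Series.1# k ℤ.+ shift (geometric r) k
      ≡⟨ geometric-suc r k ⟨
    geometric (suc r) k
      ∎
    where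
    open ≡-Reasoning
    P′ = 1-z ^ suc r
    M = lengths (monomials (suc r))
    S = lengths (anyHead (standardMonomials r))
    -- One of the r + 1 factors 1 - z is spent on the free exponent of x₁, and the other r meet the
    -- induction hypothesis.
    P′*S : P′ * S ≗ geometric r
    P′*S j = trans (1-z^suc-* r S j)
      (trans (*-congˡ (1-z ^ r) (Δ-lengths-anyHead (standardMonomials r)) j) (1-z^-*-standard r j))

-- Principal monomial ideals and monomial bases of graded quotients.

module Polynomials where

  import Algebra.Definitions.RawMonoid as RawMonoidDefs
  import Algebra.Properties.CommutativeMonoid.Sum as Sums
  import Algebra.Properties.Ring as RingProperties
  import Data.Vec.Functional as Vector
  import Relation.Binary.Reasoning.Setoid as SetoidReasoning
  open FaceCounting
  open StandardMonomials
  open import Relation.Unary using (_⊆_)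

  module _ {c ℓ} (R : CommutativeRing c ℓ) where

    generated⊆ : ∀ {s i} {S : Pred (CommutativeRing.Carrier R) s} (I : Ideal R i) →
                 S ⊆ Ideal.member I → Generated R S ⊆ Ideal.member I
    generated⊆ I S⊆I (generator s)  = S⊆I s
    generated⊆ I S⊆I (≈-closed e g) = Ideal.resp I e (generated⊆ I S⊆I g)
    generated⊆ I S⊆I 0-closed       = Ideal.0∈ I
    generated⊆ I S⊆I (+-closed g h) = Ideal.+∈ I (generated⊆ I S⊆I g) (generated⊆ I S⊆I h)
    generated⊆ I S⊆I (*-closed x g) = Ideal.*∈ I x (generated⊆ I S⊆I g)

    open CommutativeRing R hiding (refl)

    principal⇒multiple : ∀ {g x} → Generated R ｛ g ｝ x → ∃[ q ] x ≈ q * g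
    principal⇒multiple (generator refl)  = 1# , sym (*-identityˡ _)
    principal⇒multiple (≈-closed x≈y m) with principal⇒multiple m
    ... | q , eq = q , trans (sym x≈y) eq
    principal⇒multiple 0-closed          = 0# , sym (zeroˡ _)
    principal⇒multiple (+-closed m m′) with principal⇒multiple m | principal⇒multiple m′
    ... | q , eq | q′ , eq′ = q + q′ , trans (+-cong eq eq′) (sym (distribʳ _ q q′))
    principal⇒multiple (*-closed x m) with principal⇒multiple m
    ... | q , eq = x * q , trans (*-congˡ eq) (sym (*-assoc x q _))

  ·ᵐ-factor : ∀ {n} {e m : Vec ℕ n} → Pointwise _≤_ e m → Vec.zipWith ℕ._+_ (Vec.zipWith _∸_ m e) e ≡ m
  ·ᵐ-factor []       = refl
  ·ᵐ-factor (p ∷ ps) = cong₂ _∷_ (ℕₚ.m∸n+n≡m p) (·ᵐ-factor ps)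

  ·ᵐ-multiple : ∀ {n} (d e : Vec ℕ n) → Pointwise _≤_ e (Vec.zipWith ℕ._+_ d e)
  ·ᵐ-multiple []      []      = []
  ·ᵐ-multiple (x ∷ d) (y ∷ e) = ℕₚ.m≤n+m y x ∷ ·ᵐ-multiple d e

  ∏ : ∀ {n k} → (Fin k → Vec ℕ n) → Vec ℕ n
  ∏ = Vector.foldr (Vec.zipWith ℕ._+_) (Vec.replicate _ 0)

  unit : ∀ {n} → Fin n → Vec ℕ n
  unit i = Vec.replicate _ 0 Vec.[ i ]≔ 1

  ∏-∷ : ∀ {n k} (d : Fin k → Vec ℕ n) → ∏ (λ j → 0 ∷ d j) ≡ 0 ∷ ∏ d
  ∏-∷ {k = zero}  d = refl
  ∏-∷ {k = suc k} d = cong (Vec.zipWith ℕ._+_ (0 ∷ d zero)) (∏-∷ (d ∘ suc))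

  -- x₁⋯xᵣ as a product of r variables; `∏-allButLast` treats the squarefree product of r + 1
  -- factors, the last of which is 1. In both, the first variable gives the leading exponent and the
  -- remaining factors are free of it.
  ∏-inject≤ : ∀ r .(r≤ : r ≤ suc r) → ∏ (λ (i : Fin r) → unit (inject≤ i r≤)) ≡ onesButLast r
  ∏-inject≤ zero    _  = refl
  ∏-inject≤ (suc r) r≤ = ≡.trans
    (cong (Vec.zipWith ℕ._+_ (unit zero)) (∏-∷ λ i → unit (inject≤ i (s≤s⁻¹ r≤))))
    (cong (1 ∷_) (≡.trans (Vecₚ.zipWith-identityˡ ℕₚ.+-identityˡ _) (∏-inject≤ r (s≤s⁻¹ r≤))))

  ∏-allButLast : ∀ r →
    ∏ (λ i → if Vec.lookup (allButLast r) i then unit i else Vec.replicate (suc r) 0) ≡ onesButLast r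
  ∏-allButLast zero    = refl
  ∏-allButLast (suc r) = ≡.trans
    (cong (Vec.zipWith ℕ._+_ (unit zero)) (≡.trans (foldr-cong λ i → pull (Vec.lookup (allButLast r) i) i) (∏-∷ d)))
    (cong (1 ∷_) (≡.trans (Vecₚ.zipWith-identityˡ ℕₚ.+-identityˡ _) (∏-allButLast r)))
    where
    d : Fin (suc r) → Vec ℕ (suc r)
    d i = if Vec.lookup (allButLast r) i then unit i else Vec.replicate (suc r) 0
    pull : ∀ b i → (if b then unit (suc i) else Vec.replicate (suc (suc r)) 0)
                  ≡ 0 ∷ (if b then unit i else Vec.replicate (suc r) 0)
    pull true  i = refl
    pull false i = refl
    foldr-cong : ∀ {n k} {d e : Fin k → Vec ℕ n} → (∀ i → d i ≡ e i) → ∏ d ≡ ∏ e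
    foldr-cong {k = zero}  d≡e = refl
    foldr-cong {k = suc k} d≡e = cong₂ (Vec.zipWith ℕ._+_) (d≡e zero) (foldr-cong (d≡e ∘ suc))

  module PolynomialProperties {c ℓ} (K : CommutativeRing c ℓ) (n : ℕ) where
    private
      module K  = CommutativeRing K
      module Kₚ = RingProperties K.ring
      module K∑ = Sums K.+-commutativeMonoid
    open Polynomial K n
    private module P = CommutativeRing ring
    open SetoidReasoning K.setoid

    monomial : Monomial → Poly
    monomial e = (K.1# , e) ∷ []

    term-cong : ∀ {a b} e → a K.≈ b → (a , e) ∷ [] ≋ (b , e) ∷ []
    term-cong e a≈b m with e ≟ᵐ m
    ... | yes _ = K.+-congʳ a≈b
    ... | no  _ = K.refl

    coeff-monomial-≡ : ∀ e → coeff (monomial e) e K.≈ K.1#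
    coeff-monomial-≡ e with e ≟ᵐ e
    ... | yes _  = K.+-identityʳ K.1#
    ... | no e≢e = contradiction refl e≢e

    coeff-monomial-≢ : ∀ {e m} → e ≢ m → coeff (monomial e) m K.≈ K.0#
    coeff-monomial-≢ {e} {m} e≢m with e ≟ᵐ m
    ... | yes e≡m = contradiction e≡m e≢m
    ... | no  _   = K.+-identityʳ K.0#

    homogeneous-monomial : ∀ {e d} → degree e ≡ d → Homogeneous d (monomial e)
    homogeneous-monomial {e} refl m m≢d = coeff-monomial-≢ {e} {m} λ { refl → m≢d refl }

    product-monomials : ∀ {k} {f : Fin k → Poly} (d : Fin k → Monomial) →
                        (∀ i → f i ≡ monomial (d i)) → product f ≋ monomial (∏ d)
    product-monomials {zero}      d f≡ = λ _ → K.refl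
    product-monomials {suc k} {f} d f≡ = P.trans {product f} {monomial (d zero) · monomial (∏ (d ∘ suc))} {monomial (∏ d)}
      (·-cong {f zero} {monomial (d zero)} {product (f ∘ suc)} {monomial (∏ (d ∘ suc))}
        (P.reflexive (f≡ zero)) (product-monomials (d ∘ suc) (f≡ ∘ suc)))
      (term-cong (∏ d) (K.*-identityˡ K.1#))

    module MonomialIdeal (e₀ : Monomial) where
      infix 4 _∣?_
      _∣?_ : (e m : Monomial) → Dec (Pointwise _≤_ e m)
      _∣?_ = decidable ℕₚ._≤?_

      J : Ideal ring _
      J = ⟨ ring ⟩ ｛ monomial e₀ ｝

      -- An element of the ideal is a single multiple q · x^e₀, and every monomial produced by that
      -- product is divisible by x^e₀.
      coeff-∈ : ∀ {p} → Ideal.member J p → ∀ m → ¬ Pointwise _≤_ e₀ m → coeff p m K.≈ K.0#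
      coeff-∈ {p} p∈J m e₀∤m with principal⇒multiple ring p∈J
      ... | q , p≋q·e₀ = begin
        coeff p m
          ≈⟨ p≋q·e₀ m ⟩
        coeff (q · monomial e₀) m
          ≈⟨ coeff≈eval (q · monomial e₀) m ⟩
        eval (δ m) (q · monomial e₀)
          ≈⟨ eval-· (δ m) q (monomial e₀) ⟩
        eval (λ d → K.1# K.* δ m (d ·ᵐ e₀) K.+ K.0#) q
          ≈⟨ eval-cong (λ d → K.trans (K.+-identityʳ _) (K.trans (K.*-identityˡ _) (δ≈0 d))) q ⟩
        eval (λ _ → K.0#) q
          ≈⟨ eval-0 q ⟩
        K.0#
          ∎
        where
        δ≈0 : ∀ d → δ m (d ·ᵐ e₀) K.≈ K.0#
        δ≈0 d with (d ·ᵐ e₀) ≟ᵐ m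
        ... | yes refl = contradiction (·ᵐ-multiple d e₀) e₀∤m
        ... | no  _    = K.refl

      multiples : Poly → Poly
      multiples []            = []
      multiples ((a , e) ∷ p) with e₀ ∣? e
      ... | yes _ = (a , e) ∷ multiples p
      ... | no  _ = multiples p

      multiples∈ : ∀ p → Ideal.member J (multiples p)
      multiples∈ []            = 0-closed
      multiples∈ ((a , e) ∷ p) with e₀ ∣? e
      ... | no  _    = multiples∈ p
      ... | yes e₀∣e = +-closed {x = (a , e) ∷ []} {multiples p}
        (≈-closed {x = ((a , e ÷ᵐ e₀) ∷ []) · monomial e₀} {(a , e) ∷ []}
          (subst (λ m → (a K.* K.1# , (e ÷ᵐ e₀) ·ᵐ e₀) ∷ [] ≋ (a , m) ∷ []) (·ᵐ-factor e₀∣e)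
            (term-cong ((e ÷ᵐ e₀) ·ᵐ e₀) (K.*-identityʳ a)))
          (*-closed ((a , e ÷ᵐ e₀) ∷ []) (generator refl)))
        (multiples∈ p)

      coeff-multiples : ∀ p m → Pointwise _≤_ e₀ m → coeff (multiples p) m K.≈ coeff p m
      coeff-multiples []            m e₀∣m = K.refl
      coeff-multiples ((a , e) ∷ p) m e₀∣m with e₀ ∣? e
      ... | yes _    = K.+-congˡ (coeff-multiples p m e₀∣m)
      ... | no  e₀∤e with e ≟ᵐ m
      ...   | yes refl = contradiction e₀∣m e₀∤e
      ...   | no  _    = K.trans (coeff-multiples p m e₀∣m) (K.sym (K.+-identityˡ _))

      -- A formal sum may contain terms not divisible by x^e₀ that merely cancel. So `p` is
      -- compared, coefficient by coefficient, with the sublist of its divisible terms, which lies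
      -- in the ideal term by term.
      ∈-coeff : ∀ {p} → (∀ m → ¬ Pointwise _≤_ e₀ m → coeff p m K.≈ K.0#) → Ideal.member J p
      ∈-coeff {p} vanish = Ideal.resp J {multiples p} {p} agree (multiples∈ p)
        where
        agree : multiples p ≋ p
        agree m with e₀ ∣? m
        ... | yes e₀∣m = coeff-multiples p m e₀∣m
        ... | no  e₀∤m = K.trans (coeff-∈ (multiples∈ p) m e₀∤m) (K.sym (vanish m e₀∤m))

    -- By the two membership hypotheses, a class modulo `I` is determined by the coefficients of any
    -- representative at the standard monomials. In degree d these coefficients are the coordinates.
    module GradedBasis
      {i s} (I : Ideal ring i) {Standard : Pred Monomial s}
      (coeff-∈ : ∀ {p} → Ideal.member I p → ∀ m → Standard m → coeff p m K.≈ K.0#)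
      (∈-coeff : ∀ {p} → (∀ m → Standard m → coeff p m K.≈ K.0#) → Ideal.member I p)
      (d : ℕ) {N} (b : Fin N → Monomial) (b-injective : Injective _≡_ _≡_ b)
      (b-standard : ∀ j → Standard (b j)) (b-degree : ∀ j → degree (b j) ≡ d)
      (b-complete : ∀ m → Standard m → degree m ≡ d → ∃[ j ] b j ≡ m)
      where

      private
        M = gradedPiece I d
        module M = Module M
        open RawMonoidDefs M.+ᴹ-rawMonoid using (sum)

      basis : Fin N → M.Carrierᴹ
      basis j = monomial (b j) , homogeneous-monomial {b j} (b-degree j)

      coeff-sum : ∀ {k} (f : Fin k → M.Carrierᴹ) m → coeff (proj₁ (sum f)) m K.≈ K∑.sum λ j → coeff (proj₁ (f j)) m
      coeff-sum {zero}  f m = K.refl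
      coeff-sum {suc k} f m = K.trans (coeff-++ (proj₁ (f zero)) _ m) (K.+-congˡ (coeff-sum (f ∘ suc) m))

      combination : (Fin N → K.Carrier) → M.Carrierᴹ
      combination a = sum λ j → a j M.*ₗ basis j

      sum-δ : ∀ {k} (f : Fin k → K.Carrier) j → (∀ j′ → j′ ≢ j → f j′ K.≈ K.0#) → K∑.sum f K.≈ f j
      sum-δ {suc k} f j vanish = begin
        K∑.sum f                          ≈⟨ K∑.sum-remove {i = j} f ⟩
        f j K.+ K∑.sum (Vector.removeAt f j)   ≈⟨ K.+-congˡ (K∑.sum-cong-≋ λ j′ → vanish _ (Finₚ.punchInᵢ≢i j j′)) ⟩
        f j K.+ K∑.sum (Vector.replicate k K.0#) ≈⟨ K.+-congˡ (K∑.sum-replicate-zero k) ⟩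
        f j K.+ K.0#                      ≈⟨ K.+-identityʳ (f j) ⟩
        f j                               ∎

      coeff-combination : ∀ a j → coeff (proj₁ (combination a)) (b j) K.≈ a j
      coeff-combination a j = begin
        coeff (proj₁ (combination a)) (b j)
          ≈⟨ coeff-sum (λ j′ → a j′ M.*ₗ basis j′) (b j) ⟩
        K∑.sum (λ j′ → coeff (const (a j′) · monomial (b j′)) (b j))
          ≈⟨ sum-δ _ j (λ j′ j′≢j → K.trans (coeff-const· (a j′) (monomial (b j′)) (b j))
               (K.trans (K.*-congˡ (coeff-monomial-≢ (j′≢j ∘ b-injective))) (K.zeroʳ (a j′)))) ⟩
        coeff (const (a j) · monomial (b j)) (b j)
          ≈⟨ coeff-const· (a j) (monomial (b j)) (b j) ⟩
        a j K.* coeff (monomial (b j)) (b j)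
          ≈⟨ K.*-congˡ (coeff-monomial-≡ (b j)) ⟩
        a j K.* K.1#
          ≈⟨ K.*-identityʳ (a j) ⟩
        a j
          ∎

      coeff-difference : ∀ p q m → coeff (p ++ neg q) m K.≈ coeff p m K.- coeff q m
      coeff-difference p q m = K.trans (coeff-++ p (neg q) m) (K.+-congˡ (coeff-neg q m))

      spanning : ∀ x → Σ[ a ∈ (Fin N → K.Carrier) ] x M.≈ᴹ combination a
      spanning (p , hp) = a , ∈-coeff λ m std → K.trans (coeff-difference p (proj₁ (combination a)) m)
                                                        (Kₚ.x≈y⇒x∙y⁻¹≈ε (agree m std))
        where
        a : Fin N → K.Carrier
        a j = coeff p (b j)
        -- Outside degree d both coefficients vanish by homogeneity; in degree d the monomial is
        -- some `b j`.
        agree : ∀ m → Standard m → coeff p m K.≈ coeff (proj₁ (combination a)) m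
        agree m std with degree m ℕₚ.≟ d
        ... | no m≢d = K.trans (hp m m≢d) (K.sym (proj₂ (combination a) m m≢d))
        ... | yes m≡d with b-complete m std m≡d
        ...   | j , refl = K.sym (coeff-combination a j)

      independent : ∀ a → combination a M.≈ᴹ M.0ᴹ → ∀ j → a j K.≈ K.0#
      independent a a≈0 j = begin
        a j                                                 ≈⟨ coeff-combination a j ⟨
        coeff (proj₁ (combination a)) (b j)                 ≈⟨ K.+-identityʳ _ ⟨
        -- Vanishing in the quotient is membership of the difference with zero, which is the list
        -- `combination a ++ []`.
        coeff (proj₁ (combination a)) (b j) K.+ K.0#        ≈⟨ coeff-++ (proj₁ (combination a)) [] (b j) ⟨
        coeff (proj₁ (combination a) ++ []) (b j)           ≈⟨ coeff-∈ a≈0 (b j) (b-standard j) ⟩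
        K.0#                                                ∎

-- The broken-circuit ideal, the h-polynomial and the Hilbert series of the cycle graph.

open import Data.List.Membership.Propositional.Properties using (∈-lookup)
import Data.List.Relation.Unary.All as All
open import Data.List.Relation.Unary.AllPairs using (_∷_)
import Data.List.Relation.Unary.Any as Any
open import Data.List.Relation.Unary.Any.Properties using (lookup-index)
open import Data.List.Relation.Unary.Unique.Propositional using (Unique)
open PowerSeries
open FaceCounting
open CycleGraph
open StandardMonomials
open Polynomials
open ≡ using (sym; trans)

lookup-injective : ∀ {a} {A : Set a} {xs : List.List A} → Unique xs → Injective _≡_ _≡_ (List.lookup xs)
lookup-injective (x∉ ∷ u) {zero}  {zero}  eq = refl
lookup-injective (x∉ ∷ u) {zero}  {suc j} eq = contradiction eq (All.lookup x∉ (∈-lookup j))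
lookup-injective (x∉ ∷ u) {suc i} {zero}  eq = contradiction (sym eq) (All.lookup x∉ (∈-lookup i))
lookup-injective (x∉ ∷ u) {suc i} {suc j} eq = cong suc (lookup-injective u eq)

module _ {c ℓ} (R : CommutativeRing c ℓ) where
  open CommutativeRing R using (_≈_) renaming (sym to ≈-sym)

  -- Generators are matched by `_≡_`, whereas the expressions for x₁⋯xᵣ agree only in the equality
  -- of the polynomial ring.
  ⟨｛｝⟩-cong : ∀ {x y} → x ≈ y → Generated R ｛ x ｝ ≐ Generated R ｛ y ｝
  ⟨｛｝⟩-cong {x} {y} x≈y =
    generated⊆ R (⟨_⟩ R ｛ y ｝) (λ { refl → ≈-closed (≈-sym x≈y) (generator refl) }) ,
    generated⊆ R (⟨_⟩ R ｛ x ｝) (λ { refl → ≈-closed x≈y (generator refl) })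

  -- Equality in a quotient is membership of the difference, so one inclusion makes the identity
  -- well defined and the other makes it injective.
  quotient-≐ : ∀ {i j} (I : Ideal R i) (J : Ideal R j) → Ideal.member I ≐ Ideal.member J →
               RingMorphisms.IsRingIsomorphism (CommutativeRing.rawRing (quotientRing R I))
                                               (CommutativeRing.rawRing (quotientRing R J)) id
  quotient-≐ I J (I⊆J , J⊆I) = record
    { isRingMonomorphism = record
      { isRingHomomorphism = record
        { isSemiringHomomorphism = record
          { isNearSemiringHomomorphism = record
            { +-isMonoidHomomorphism = record
              { isMagmaHomomorphism = record
                { isRelHomomorphism = record { cong = I⊆J }
                ; homo = λ x y → R/J.refl
                }
              ; ε-homo = R/J.refl
              }
            ; *-homo = λ x y → R/J.refl
            }
          ; 1#-homo = R/J.refl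
          }
        ; -‿homo = λ x → R/J.refl
        }
      ; injective = J⊆I
      }
    ; surjective = λ y → y , I⊆J
    }
    where module R/J = CommutativeRing (quotientRing R J)

module _ {c ℓ₁ ℓ₂} (𝕜 : HeytingField c ℓ₁ ℓ₂) {r} (n≥3 : 3 ≤ suc r) (σ : Permutation′ (suc r)) where
  private module K = CommutativeRing (underlyingRing 𝕜)
  open StanleyReisner 𝕜 (cycleGraph (suc r) n≥3 σ)
  open Polynomial (underlyingRing 𝕜) (suc r)
  open PolynomialProperties (underlyingRing 𝕜) (suc r)
  open MonomialIdeal (onesButLast r)

  private module P = CommutativeRing ring

  x₁⋯xᵣ : Poly
  x₁⋯xᵣ = product λ (i : Fin r) → var (inject≤ i (m∸n≤m (suc r) 1))

  x₁⋯xᵣ≋monomial : x₁⋯xᵣ ≋ monomial (onesButLast r)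
  x₁⋯xᵣ≋monomial = subst (λ e → x₁⋯xᵣ ≋ monomial e) (∏-inject≤ r (m∸n≤m (suc r) 1))
    (product-monomials (λ (i : Fin r) → unit (inject≤ i (m∸n≤m (suc r) 1))) λ _ → refl)

  squarefree≋monomial : squarefree (allButLast r) ≋ monomial (onesButLast r)
  squarefree≋monomial = subst (λ e → squarefree (allButLast r) ≋ monomial e) (∏-allButLast r)
    (product-monomials _ λ i → factor (Vec.lookup (allButLast r) i) i)
    where
    factor : ∀ b i → (if b then var i else const K.1#) ≡ monomial (if b then unit i else 1ᵐ)
    factor true  i = refl
    factor false i = refl

  -- There is only one broken circuit, hence only one generator. The reverse inclusion uses that
  -- this set is indeed a broken circuit.
  I-BC≐J : Ideal.member I-BC ≐ Ideal.member J
  I-BC≐J =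
    generated⊆ ring J (λ { (B , bc , refl) → squarefree∈J (brokenCircuit⇒ n≥3 σ bc) }) ,
    generated⊆ ring I-BC (λ { refl → ≈-closed {x = squarefree (allButLast r)} {monomial (onesButLast r)} squarefree≋monomial
      (generator (allButLast r , brokenCircuit-allButLast n≥3 σ , refl)) })
    where
    squarefree∈J : ∀ {B} → B ≡ allButLast r → Ideal.member J (squarefree B)
    squarefree∈J refl = ≈-closed {x = monomial (onesButLast r)} {squarefree (allButLast r)}
      (P.sym {squarefree (allButLast r)} {monomial (onesButLast r)} squarefree≋monomial) (generator refl)

  principal≐J : Generated ring ｛ x₁⋯xᵣ ｝ ≐ Ideal.member J
  principal≐J = ⟨｛｝⟩-cong ring {x₁⋯xᵣ} {monomial (onesButLast r)} x₁⋯xᵣ≋monomial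

  I-BC≐principal : Ideal.member I-BC ≐ Generated ring ｛ x₁⋯xᵣ ｝
  I-BC≐principal = (λ {p} → proj₂ principal≐J {p} ∘ proj₁ I-BC≐J {p}) , λ {p} → proj₂ I-BC≐J {p} ∘ proj₁ principal≐J {p}

  -- The rank `suc r ∸ 1` reduces to `r`, so the h-polynomial unfolds to `fToH r` of the face
  -- numbers.
  h-polynomial≗geometric : h-polynomial (cycleGraph (suc r) n≥3 σ) ≗ geometric r
  h-polynomial≗geometric k = trans
    (fToH-cong r (λ i → cong +_ (#faces-avoiding (BC (cycleGraph (suc r) n≥3 σ)) face≐ i)) k) (fToH-#avoiding r k)
    where
    face≐ : SimplicialComplex.Face (BC (cycleGraph (suc r) n≥3 σ)) ≐ (λ F → ¬ (allButLast r Subset.⊆ F))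
    face≐ = (λ face → face (allButLast r) (brokenCircuit-allButLast n≥3 σ)) ,
            λ {F} ⊈F B bc → subst (λ B → ¬ (B Subset.⊆ F)) (sym (brokenCircuit⇒ n≥3 σ bc)) ⊈F

  coeff-I-BC : ∀ {p} → Ideal.member I-BC p → ∀ m → Standard r m → coeff p m K.≈ K.0#
  coeff-I-BC {p} p∈I = coeff-∈ {p} (proj₁ I-BC≐J {p} p∈I)

  ∈I-BC : ∀ {p} → (∀ m → Standard r m → coeff p m K.≈ K.0#) → Ideal.member I-BC p
  ∈I-BC {p} vanish = proj₂ I-BC≐J {p} (∈-coeff {p} vanish)

  hasDimension-standard : ∀ d → HasDimension (𝕜[BC]-graded d) (List.length (standardMonomials r d))
  hasDimension-standard d = B.basis , record { spanning = B.spanning ; independent = B.independent }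
    where
    open Enumerates (enumerates-standard r d)
    position-of : ∀ m → Standard r m → Vec.sum m ≡ d → ∃[ j ] List.lookup (standardMonomials r d) j ≡ m
    position-of m std deg = Any.index m∈ , sym (lookup-index m∈)
      where m∈ = complete (std , deg)
    module B = GradedBasis I-BC {Standard r} coeff-I-BC ∈I-BC
      d (List.lookup (standardMonomials r d)) (lookup-injective unique)
      (λ j → proj₁ (sound (∈-lookup j))) (λ j → proj₂ (sound (∈-lookup j)))
      position-of

  -- The dimensions are the lengths of the lists of standard monomials. Their series times (1 - z)^r
  -- is the numerator, so uniqueness of the quotient identifies the coefficients.
  hilbertSeries : IsHilbertSeries 𝕜[BC]-graded (geometric r ÷ 1-z Series.^ r)
  hilbertSeries d =
    List.length (standardMonomials r d) , ÷-unique r (1-z^-*-standard r) d , hasDimension-standard d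

theorem6p1 : ∀ {c ℓ₁ ℓ₂} (𝕜 : HeytingField c ℓ₁ ℓ₂) (n : ℕ) (n≥3 : 3 ≤ n) (σ : Permutation′ n) →
    let Cₙ = cycleGraph n n≥3 σ
        open StanleyReisner 𝕜 Cₙ
        open Polynomial (underlyingRing 𝕜) n
        J = ⟨ ring ⟩ ｛ product (λ (i : Fin (n ∸ 1)) → var (inject≤ i (m∸n≤m n 1))) ｝
        numerator = Series.sum (λ (i : Fin (n ∸ 1)) → z Series.^ toℕ i)
    in  Ideal.member I-BC ≐ Ideal.member J
      × RingMorphisms.IsRingIsomorphism (CommutativeRing.rawRing 𝕜[BC]) (CommutativeRing.rawRing (quotientRing ring J)) id
      × h-polynomial Cₙ ≗ numerator
      × IsHilbertSeries 𝕜[BC]-graded (numerator ÷ 1-z Series.^ (n ∸ 1))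
theorem6p1 𝕜 (suc r) n≥3 σ =
  I-BC≐principal 𝕜 n≥3 σ ,
  quotient-≐ (Polynomial.ring (underlyingRing 𝕜) (suc r)) (StanleyReisner.I-BC 𝕜 (cycleGraph (suc r) n≥3 σ))
    (⟨_⟩ (Polynomial.ring (underlyingRing 𝕜) (suc r)) _) (I-BC≐principal 𝕜 n≥3 σ) ,
  h-polynomial≗geometric 𝕜 n≥3 σ ,
  hilbertSeries 𝕜 n≥3 σ
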